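{- Let $F$ be a field, $D\in \mathrm{Der}_{\mathbb Z}(F)$ an absolute derivation, and $V_2$ a $2$-dimensional $F$-vector space with a fixed volume form. Then the square $$\begin{array}{ccc} C_4(2) & \xrightarrow{\;d\;} & C_3(2)\\ {\scriptstyle\tau^2_1}\downarrow & & \downarrow{\scriptstyle\tau^2_0}\\ \beta^D_2(F) & \xrightarrow{\;\partial^D\;} & F\otimes F^\times\end{array}$$ is commutative (modulo $2$-torsion), i.e. $\tau^2_0\circ d=\partial^D\circ\tau^2_1$ on $C_4(2)$.
   Context: All tensor products are over $\mathbb Z$; $F\otimes F^\times$ is an $F$-vector space via the left factor. $F^{\bullet\bullet}=F\setminus\{0,1\}$. A derivation $D\in\mathrm{Der}_{\mathbb Z}(F)$ is an additive map $D:F\to F$ with $D(ab)=aD(b)+bD(a)$; $D\log a:=D(a)/a$. All identities are understood modulo $2$-torsion. The space $\beta_2(F)$: $F[F^{\bullet\bullet}]$ (the $F$-vector space with basis $[a]$, $a\in F^{\bullet\bullet}$) modulo the kernel of the $F$-linear map $F[F^{\bullet\bullet}]\to F\otimes F^\times$, $[a]\mapsto a\otimes a+(1-a)\otimes(1-a)$; $\langle a\rangle_2$ is the class of $[a]$. Put $\llbracket a\rrbracket^D_2=\frac{D(a)}{a(1-a)}\langle a\rangle_2$, and let $\beta^D_2(F)\subset\beta_2(F)$ be the $F$-subspace generated by all $\llbracket a\rrbracket^D_2$, $a\in F^{\bullet\bullet}$. The $F$-linear map $\partial^D:\beta^D_2(F)\to F\otimes F^\times$ is $\partial^D(\llbracket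 a\rrbracket^D_2)=-D\log(1-a)\otimes a+D\log(a)\otimes(1-a)$. Configurations: $C_m(2)$ is the free abelian group generated by $m$-tuples of vectors $(l_0,\ldots,l_{m-1})$ in $V_2$ in generic position (any $2$ or fewer of them are linearly independent), modulo the diagonal action of $GL(V_2)$. $d(l_0,\ldots,l_{m-1})=\sum_{i=0}^{m-1}(-1)^i(l_0,\ldots,\hat l_i,\ldots,l_{m-1})$. With $\omega\in\det V_2^*$ the volume form, $\Delta(l_i,l_j)=\langle\omega,l_i\wedge l_j\rangle$. The maps: $$\tau_0^2(l_0,l_1,l_2)=\sum_{i=0}^2\Big(D\log\Delta(l_i,l_{i+2})\otimes\Delta(l_i,l_{i+1})-D\log\Delta(l_{i+1},l_i)\otimes\Delta(l_i,l_{i+2})\Big)\quad(\text{indices mod }3),$$ $$\tau_1^2(l_0,\ldots,l_3)=\llbracket r(l_0,\ldots,l_3)\rrbracket^D_2,\qquad r(l_0,\ldots,l_3)=\frac{\Delta(l_0,l_3)\Delta(l_1,l_2)}{\Delta(l_0,l_2)\Delta(l_1,l_3)}.$$ -}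

module Defs where

open import Algebra.Bundles using (AbelianGroup; CommutativeRing; Ring)
open import Algebra.Module.Bundles using (LeftModule)
open import Algebra.Module.Morphism.Structures using (IsLeftModuleHomomorphism; IsLeftModuleIsomorphism)
open import Algebra.Module.Structures using (IsLeftModule)
import Algebra.Module.Construct.TensorUnit as TensorUnit
open import Algebra.Morphism.Bundles using (GroupHomomorphism)
open import Algebra.Structures using (IsAbelianGroup)
import Algebra.Properties.AbelianGroup as AbelianGroupProperties
import Algebra.Properties.CommutativeMonoid.Sum as Sum
import Algebra.Properties.Ring as RingProperties
import Algebra.Solver.CommutativeMonoid as CommutativeMonoidSolver
import Algebra.Solver.Ring.NaturalCoefficients.Default as SemiringSolver
open import Data.Empty using (⊥-elim)
open import Data.Fin.Base using (Fin; toℕ; punchIn)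
open import Data.Fin.Patterns using (0F; 1F; 2F; 3F)
open import Data.Fin.Properties using (punchIn-injective)
open import Data.Nat.Base as ℕ using (ℕ; zero; suc)
open import Data.Nat.DivMod using (_mod_)
open import Data.Nat.Properties using (≤-refl)
open import Data.Product.Base using (Σ; ∃; _×_; _,_; proj₁; proj₂)
open import Data.Vec.Functional using (Vector; []; _∷_)
open import Function.Base using (_∘_)
open import Function.Definitions using (Injective)
open import Level using (_⊔_) renaming (suc to lsuc)
open import Relation.Binary.Bundles using (Setoid)
open import Relation.Binary.Core using (Rel)
open import Relation.Binary.PropositionalEquality.Core as ≡ using (_≡_; _≢_)
import Relation.Binary.Reasoning.Setoid as SetoidReasoning
open import Relation.Nullary.Negation.Core using (¬_)

infixl 6 _+ʷ_
infixr 8 -ʷ_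

data Word {x} (X : Set x) : Set x where
  [_]  : X → Word X
  0ʷ   : Word X
  _+ʷ_ : Word X → Word X → Word X
  -ʷ_  : Word X → Word X

mapʷ : ∀ {x y} {X : Set x} {Y : Set y} → (X → Y) → Word X → Word Y
mapʷ f [ x ]    = [ f x ]
mapʷ f 0ʷ       = 0ʷ
mapʷ f (u +ʷ v) = mapʷ f u +ʷ mapʷ f v
mapʷ f (-ʷ u)   = -ʷ mapʷ f u

-- ℤ[X] modulo the subgroup generated by the differences u − v, u ∼ v:
-- _≈ʷ_ is the least congruence containing _∼_ and the abelian group laws.

module Presentation {x r} {X : Set x} (_∼_ : Rel (Word X) r) where

  infix 4 _≈ʷ_

  data _≈ʷ_ : Rel (Word X) (x ⊔ r) where
    relation   : ∀ {u v} → u ∼ v → u ≈ʷ v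
    reflʷ      : ∀ {u} → u ≈ʷ u
    symʷ       : ∀ {u v} → u ≈ʷ v → v ≈ʷ u
    transʷ     : ∀ {u v w} → u ≈ʷ v → v ≈ʷ w → u ≈ʷ w
    +ʷ-cong    : ∀ {u u′ v v′} → u ≈ʷ u′ → v ≈ʷ v′ → u +ʷ v ≈ʷ u′ +ʷ v′
    -ʷ‿cong    : ∀ {u v} → u ≈ʷ v → -ʷ u ≈ʷ -ʷ v
    +ʷ-assoc   : ∀ u v w → (u +ʷ v) +ʷ w ≈ʷ u +ʷ (v +ʷ w)
    +ʷ-comm    : ∀ u v → u +ʷ v ≈ʷ v +ʷ u
    +ʷ-identityˡ : ∀ u → 0ʷ +ʷ u ≈ʷ u
    -ʷ‿inverseˡ  : ∀ u → -ʷ u +ʷ u ≈ʷ 0ʷ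

  abstract
    isAbelianGroup : IsAbelianGroup _≈ʷ_ _+ʷ_ 0ʷ -ʷ_
    isAbelianGroup = record
      { isGroup = record
        { isMonoid = record
          { isSemigroup = record
            { isMagma = record
              { isEquivalence = record { refl = reflʷ ; sym = symʷ ; trans = transʷ }
              ; ∙-cong = +ʷ-cong
              }
            ; assoc = +ʷ-assoc
            }
          ; identity = +ʷ-identityˡ , λ u → transʷ (+ʷ-comm u 0ʷ) (+ʷ-identityˡ u)
          }
        ; inverse = -ʷ‿inverseˡ , λ u → transʷ (+ʷ-comm u (-ʷ u)) (-ʷ‿inverseˡ u)
        ; ⁻¹-cong = -ʷ‿cong
        }
      ; comm = +ʷ-comm
      }

  abelianGroup : AbelianGroup x (x ⊔ r)
  abelianGroup = record
    { Carrier = Word X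
    ; _≈_ = _≈ʷ_
    ; _∙_ = _+ʷ_
    ; ε = 0ʷ
    ; _⁻¹ = -ʷ_
    ; isAbelianGroup = isAbelianGroup
    }

  module _ {a ℓ} (G : AbelianGroup a ℓ) where
    open AbelianGroup G

    extend : (X → Carrier) → Word X → Carrier
    extend f [ x ]    = f x
    extend f 0ʷ       = ε
    extend f (u +ʷ v) = extend f u ∙ extend f v
    extend f (-ʷ u)   = extend f u ⁻¹

    module _ (f : X → Carrier)
             (respects : ∀ {u v} → u ∼ v → extend f u ≈ extend f v) where

      extend-cong : ∀ {u v} → u ≈ʷ v → extend f u ≈ extend f v
      extend-cong (relation u∼v)    = respects u∼v
      extend-cong reflʷ             = refl
      extend-cong (symʷ p)          = sym (extend-cong p)
      extend-cong (transʷ p q)      = trans (extend-cong p) (extend-cong q)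
      extend-cong (+ʷ-cong p q)     = ∙-cong (extend-cong p) (extend-cong q)
      extend-cong (-ʷ‿cong p)       = ⁻¹-cong (extend-cong p)
      extend-cong (+ʷ-assoc u v w)  = assoc _ _ _
      extend-cong (+ʷ-comm u v)     = comm _ _
      extend-cong (+ʷ-identityˡ u)  = identityˡ _
      extend-cong (-ʷ‿inverseˡ u)   = inverseˡ _

      extendHom : GroupHomomorphism (AbelianGroup.rawGroup abelianGroup) rawGroup
      extendHom = record
        { ⟦_⟧ = extend f
        ; isGroupHomomorphism = record
          { isMonoidHomomorphism = record
            { isMagmaHomomorphism = record
              { isRelHomomorphism = record { cong = extend-cong }
              ; homo = λ _ _ → refl
              }
            ; ε-homo = refl
            }
          ; ⁻¹-homo = λ _ → refl
          }
        }

-- The R-module structure on a presented abelian group whose generators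
-- carry an action of R that satisfies the module laws modulo the relations.

module ScaledPresentation {r ℓr x s} (R : Ring r ℓr) {X : Set x} (_∼_ : Rel (Word X) s)
                          (_·_ : Ring.Carrier R → X → X) where
  open Ring R
  open Presentation _∼_

  module _
    (·-resp      : ∀ a {u v} → u ∼ v → mapʷ (a ·_) u ≈ʷ mapʷ (a ·_) v)
    (·-congʳ     : ∀ {a b} x → a ≈ b → [ a · x ] ≈ʷ [ b · x ])
    (·-distribʳ  : ∀ a b x → [ (a + b) · x ] ≈ʷ [ a · x ] +ʷ [ b · x ])
    (·-assoc     : ∀ a b x → [ (a * b) · x ] ≈ʷ [ a · (b · x) ])
    (·-identityˡ : ∀ x → [ 1# · x ] ≈ʷ [ x ])
    where

    private
      module G = AbelianGroup abelianGroup
      module GP = AbelianGroupProperties abelianGroup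
      open SetoidReasoning G.setoid

      interchange : ∀ u v w z → (u +ʷ v) +ʷ (w +ʷ z) ≈ʷ (u +ʷ w) +ʷ (v +ʷ z)
      interchange u v w z = S.solve 4
        (λ u v w z → (u S.⊕ v) S.⊕ (w S.⊕ z) S.⊜ (u S.⊕ w) S.⊕ (v S.⊕ z)) reflʷ u v w z
        where module S = CommutativeMonoidSolver G.commutativeMonoid

      congˡ : ∀ a {u v} → u ≈ʷ v → mapʷ (a ·_) u ≈ʷ mapʷ (a ·_) v
      congˡ a (relation u∼v)    = ·-resp a u∼v
      congˡ a reflʷ             = reflʷ
      congˡ a (symʷ p)          = symʷ (congˡ a p)
      congˡ a (transʷ p q)      = transʷ (congˡ a p) (congˡ a q)
      congˡ a (+ʷ-cong p q)     = +ʷ-cong (congˡ a p) (congˡ a q)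
      congˡ a (-ʷ‿cong p)       = -ʷ‿cong (congˡ a p)
      congˡ a (+ʷ-assoc u v w)  = +ʷ-assoc _ _ _
      congˡ a (+ʷ-comm u v)     = +ʷ-comm _ _
      congˡ a (+ʷ-identityˡ u)  = +ʷ-identityˡ _
      congˡ a (-ʷ‿inverseˡ u)   = -ʷ‿inverseˡ _

      congʳ : ∀ {a b} u → a ≈ b → mapʷ (a ·_) u ≈ʷ mapʷ (b ·_) u
      congʳ [ x ]    p = ·-congʳ x p
      congʳ 0ʷ       p = reflʷ
      congʳ (u +ʷ v) p = +ʷ-cong (congʳ u p) (congʳ v p)
      congʳ (-ʷ u)   p = -ʷ‿cong (congʳ u p)

      distribʳʷ : ∀ u a b → mapʷ ((a + b) ·_) u ≈ʷ mapʷ (a ·_) u +ʷ mapʷ (b ·_) u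
      distribʳʷ [ x ]    a b = ·-distribʳ a b x
      distribʳʷ 0ʷ       a b = symʷ (+ʷ-identityˡ 0ʷ)
      distribʳʷ (u +ʷ v) a b = transʷ (+ʷ-cong (distribʳʷ u a b) (distribʳʷ v a b)) (interchange _ _ _ _)
      distribʳʷ (-ʷ u)   a b = transʷ (-ʷ‿cong (distribʳʷ u a b)) (symʷ (GP.⁻¹-∙-comm _ _))

      assocʷ : ∀ a b u → mapʷ ((a * b) ·_) u ≈ʷ mapʷ (a ·_) (mapʷ (b ·_) u)
      assocʷ a b [ x ]    = ·-assoc a b x
      assocʷ a b 0ʷ       = reflʷ
      assocʷ a b (u +ʷ v) = +ʷ-cong (assocʷ a b u) (assocʷ a b v)
      assocʷ a b (-ʷ u)   = -ʷ‿cong (assocʷ a b u)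

      identityˡʷ : ∀ u → mapʷ (1# ·_) u ≈ʷ u
      identityˡʷ [ x ]    = ·-identityˡ x
      identityˡʷ 0ʷ       = reflʷ
      identityˡʷ (u +ʷ v) = +ʷ-cong (identityˡʷ u) (identityˡʷ v)
      identityˡʷ (-ʷ u)   = -ʷ‿cong (identityˡʷ u)

      zeroˡʷ : ∀ u → mapʷ (0# ·_) u ≈ʷ 0ʷ
      zeroˡʷ u = GP.identityˡ-unique _ _
        (transʷ (symʷ (distribʳʷ u 0# 0#)) (congʳ u (+-identityˡ 0#)))

    abstract
      isLeftModule : IsLeftModule R _≈ʷ_ _+ʷ_ 0ʷ -ʷ_ (λ a → mapʷ (a ·_))
      isLeftModule = record
        { isLeftSemimodule = record
          { +ᴹ-isCommutativeMonoid = G.isCommutativeMonoid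
          ; isPreleftSemimodule = record
            { *ₗ-cong = λ {_} {b} {u} p q → transʷ (congʳ u p) (congˡ b q)
            ; *ₗ-zeroˡ = zeroˡʷ
            ; *ₗ-distribʳ = distribʳʷ
            ; *ₗ-identityˡ = identityˡʷ
            ; *ₗ-assoc = assocʷ
            ; *ₗ-zeroʳ = λ _ → reflʷ
            ; *ₗ-distribˡ = λ _ _ _ → reflʷ
            }
          }
        ; -ᴹ‿cong = -ʷ‿cong
        ; -ᴹ‿inverse = G.inverse
        }

    leftModule : LeftModule R x (x ⊔ s)
    leftModule = record
      { Carrierᴹ = Word X
      ; _≈ᴹ_ = _≈ʷ_
      ; _+ᴹ_ = _+ʷ_
      ; _*ₗ_ = λ a → mapʷ (a ·_)
      ; 0ᴹ = 0ʷ
      ; -ᴹ_ = -ʷ_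
      ; isLeftModule = isLeftModule
      }

record LinearMap {r ℓr a ℓa b ℓb} {R : Ring r ℓr}
                 (M : LeftModule R a ℓa) (N : LeftModule R b ℓb) : Set (r ⊔ a ⊔ ℓa ⊔ b ⊔ ℓb) where
  private
    module M = LeftModule M
    module N = LeftModule N
  field
    ⟦_⟧ : M.Carrierᴹ → N.Carrierᴹ
    isLeftModuleHomomorphism : IsLeftModuleHomomorphism M.rawLeftModule N.rawLeftModule ⟦_⟧
  open IsLeftModuleHomomorphism isLeftModuleHomomorphism public

record Submodule {r ℓr m ℓm} {R : Ring r ℓr} (M : LeftModule R m ℓm) p
                 : Set (r ⊔ m ⊔ ℓm ⊔ lsuc p) where
  open Ring R using (Carrier)
  open LeftModule M
  field
    Member   : Carrierᴹ → Set p
    resp     : ∀ {u v} → u ≈ᴹ v → Member u → Member v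
    0-closed : Member 0ᴹ
    +-closed : ∀ {u v} → Member u → Member v → Member (u +ᴹ v)
    neg-closed : ∀ {u} → Member u → Member (-ᴹ u)
    *-closed : ∀ a {u} → Member u → Member (a *ₗ u)

module _ {r ℓr m ℓm p} {R : Ring r ℓr} {M : LeftModule R m ℓm} (N : Submodule M p) where
  private
    module R = Ring R
  open LeftModule M
  open Submodule N

  private abstract
    sub-isLeftModule : IsLeftModule R
      (λ (u v : Σ Carrierᴹ Member) → proj₁ u ≈ᴹ proj₁ v)
      (λ (u , p) (v , q) → u +ᴹ v , +-closed p q)
      (0ᴹ , 0-closed)
      (λ (u , p) → -ᴹ u , neg-closed p)
      (λ a (u , p) → a *ₗ u , *-closed a p)
    sub-isLeftModule = record
      { isLeftSemimodule = record
        { +ᴹ-isCommutativeMonoid = record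
          { isMonoid = record
            { isSemigroup = record
              { isMagma = record
                { isEquivalence = record { refl = ≈ᴹ-refl ; sym = ≈ᴹ-sym ; trans = ≈ᴹ-trans }
                ; ∙-cong = +ᴹ-cong
                }
              ; assoc = λ _ _ _ → +ᴹ-assoc _ _ _
              }
            ; identity = (λ _ → +ᴹ-identityˡ _) , (λ _ → +ᴹ-identityʳ _)
            }
          ; comm = λ _ _ → +ᴹ-comm _ _
          }
        ; isPreleftSemimodule = record
          { *ₗ-cong = *ₗ-cong
          ; *ₗ-zeroˡ = λ _ → *ₗ-zeroˡ _
          ; *ₗ-distribʳ = λ _ _ _ → *ₗ-distribʳ _ _ _
          ; *ₗ-identityˡ = λ _ → *ₗ-identityˡ _
          ; *ₗ-assoc = λ _ _ _ → *ₗ-assoc _ _ _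
          ; *ₗ-zeroʳ = λ _ → *ₗ-zeroʳ _
          ; *ₗ-distribˡ = λ _ _ _ → *ₗ-distribˡ _ _ _
          }
        }
      ; -ᴹ‿cong = -ᴹ‿cong
      ; -ᴹ‿inverse = (λ _ → -ᴹ‿inverseˡ _) , (λ _ → -ᴹ‿inverseʳ _)
      }

  ⟨_⟩ : LeftModule R (m ⊔ p) ℓm
  ⟨_⟩ = record
    { Carrierᴹ = Σ Carrierᴹ Member
    ; _≈ᴹ_ = λ u v → proj₁ u ≈ᴹ proj₁ v
    ; _+ᴹ_ = λ (u , p) (v , q) → u +ᴹ v , +-closed p q
    ; _*ₗ_ = λ a (u , p) → a *ₗ u , *-closed a p
    ; 0ᴹ = 0ᴹ , 0-closed
    ; -ᴹ_ = λ (u , p) → -ᴹ u , neg-closed p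
    ; isLeftModule = sub-isLeftModule
    }

module _ {r ℓr m ℓm} {R : Ring r ℓr} (M : LeftModule R m ℓm) where
  private
    module R = Ring R
  open LeftModule M
  private
    module MP = AbelianGroupProperties +ᴹ-abelianGroup
    open SetoidReasoning ≈ᴹ-setoid

    *ₗ-neg : ∀ a u → -ᴹ (a *ₗ u) ≈ᴹ a *ₗ (-ᴹ u)
    *ₗ-neg a u = ≈ᴹ-sym (MP.inverseˡ-unique _ _ (begin
      a *ₗ (-ᴹ u) +ᴹ a *ₗ u ≈⟨ *ₗ-distribˡ a (-ᴹ u) u ⟨
      a *ₗ (-ᴹ u +ᴹ u)      ≈⟨ *ₗ-congˡ (-ᴹ‿inverseˡ u) ⟩
      a *ₗ 0ᴹ               ≈⟨ *ₗ-zeroʳ a ⟩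
      0ᴹ                    ∎))

  module _ {p} (N : Submodule M p) where
    private
      open Submodule N
      module S = CommutativeMonoidSolver +ᴹ-commutativeMonoid

      infix 4 _≈_
      _≈_ : Rel Carrierᴹ p
      u ≈ v = Member (u +ᴹ -ᴹ v)

      abstract
        lift : ∀ {u v} → u ≈ᴹ v → u ≈ v
        lift p = resp (≈ᴹ-sym (MP.x≈y⇒x∙y⁻¹≈ε p)) 0-closed

        symm : ∀ {u v} → u ≈ v → v ≈ u
        symm p = resp (MP.⁻¹-anti-homo‿- _ _) (neg-closed p)

        transi : ∀ {u v w} → u ≈ v → v ≈ w → u ≈ w
        transi {u} {v} {w} p q = resp (begin
          (u +ᴹ -ᴹ v) +ᴹ (v +ᴹ -ᴹ w) ≈⟨ S.solve 4 (λ u v′ v w′ →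
              (u S.⊕ v′) S.⊕ (v S.⊕ w′) S.⊜ (u S.⊕ w′) S.⊕ (v′ S.⊕ v)) ≈ᴹ-refl u (-ᴹ v) v (-ᴹ w) ⟩
          (u +ᴹ -ᴹ w) +ᴹ (-ᴹ v +ᴹ v) ≈⟨ +ᴹ-congˡ (-ᴹ‿inverseˡ v) ⟩
          (u +ᴹ -ᴹ w) +ᴹ 0ᴹ          ≈⟨ +ᴹ-identityʳ _ ⟩
          u +ᴹ -ᴹ w                  ∎) (+-closed p q)

        cong-+ : ∀ {u u′ v v′} → u ≈ u′ → v ≈ v′ → u +ᴹ v ≈ u′ +ᴹ v′
        cong-+ {u} {u′} {v} {v′} p q = resp (begin
          (u +ᴹ -ᴹ u′) +ᴹ (v +ᴹ -ᴹ v′) ≈⟨ S.solve 4 (λ u u′ v v′ →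
              (u S.⊕ u′) S.⊕ (v S.⊕ v′) S.⊜ (u S.⊕ v) S.⊕ (u′ S.⊕ v′)) ≈ᴹ-refl u (-ᴹ u′) v (-ᴹ v′) ⟩
          (u +ᴹ v) +ᴹ (-ᴹ u′ +ᴹ -ᴹ v′) ≈⟨ +ᴹ-congˡ (MP.⁻¹-∙-comm u′ v′) ⟩
          (u +ᴹ v) +ᴹ -ᴹ (u′ +ᴹ v′)    ∎) (+-closed p q)

        cong-neg : ∀ {u v} → u ≈ v → -ᴹ u ≈ -ᴹ v
        cong-neg {u} {v} p = resp (≈ᴹ-sym (MP.⁻¹-∙-comm u (-ᴹ v))) (neg-closed p)

        cong-* : ∀ a {u v} → u ≈ v → a *ₗ u ≈ a *ₗ v
        cong-* a {u} {v} p = resp (begin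
          a *ₗ (u +ᴹ -ᴹ v)        ≈⟨ *ₗ-distribˡ a u (-ᴹ v) ⟩
          a *ₗ u +ᴹ a *ₗ (-ᴹ v)   ≈⟨ +ᴹ-congˡ (*ₗ-neg a v) ⟨
          a *ₗ u +ᴹ -ᴹ (a *ₗ v)   ∎) (*-closed a p)

        quotient-isLeftModule : IsLeftModule R _≈_ _+ᴹ_ 0ᴹ -ᴹ_ _*ₗ_
        quotient-isLeftModule = record
          { isLeftSemimodule = record
            { +ᴹ-isCommutativeMonoid = record
              { isMonoid = record
                { isSemigroup = record
                  { isMagma = record
                    { isEquivalence = record { refl = lift ≈ᴹ-refl ; sym = symm ; trans = transi }
                    ; ∙-cong = cong-+
                    }
                  ; assoc = λ u v w → lift (+ᴹ-assoc u v w)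
                  }
                ; identity = (λ u → lift (+ᴹ-identityˡ u)) , (λ u → lift (+ᴹ-identityʳ u))
                }
              ; comm = λ u v → lift (+ᴹ-comm u v)
              }
            ; isPreleftSemimodule = record
              { *ₗ-cong = λ {a} {b} {u} p q → transi (lift (*ₗ-congʳ p)) (cong-* b q)
              ; *ₗ-zeroˡ = λ u → lift (*ₗ-zeroˡ u)
              ; *ₗ-distribʳ = λ u a b → lift (*ₗ-distribʳ u a b)
              ; *ₗ-identityˡ = λ u → lift (*ₗ-identityˡ u)
              ; *ₗ-assoc = λ a b u → lift (*ₗ-assoc a b u)
              ; *ₗ-zeroʳ = λ a → lift (*ₗ-zeroʳ a)
              ; *ₗ-distribˡ = λ a u v → lift (*ₗ-distribˡ a u v)
              }
            }
          ; -ᴹ‿cong = cong-neg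
          ; -ᴹ‿inverse = (λ u → lift (-ᴹ‿inverseˡ u)) , (λ u → lift (-ᴹ‿inverseʳ u))
          }

    infix 5 _/_

    _/_ : LeftModule R m p
    _/_ = record
      { Carrierᴹ = Carrierᴹ
      ; _≈ᴹ_ = _≈_
      ; _+ᴹ_ = _+ᴹ_
      ; _*ₗ_ = _*ₗ_
      ; 0ᴹ = 0ᴹ
      ; -ᴹ_ = -ᴹ_
      ; isLeftModule = quotient-isLeftModule
      }

    projection : LinearMap M _/_
    projection = record
      { ⟦_⟧ = λ u → u
      ; isLeftModuleHomomorphism = record
        { +ᴹ-isGroupHomomorphism = record
          { isMonoidHomomorphism = record
            { isMagmaHomomorphism = record
              { isRelHomomorphism = record { cong = lift }
              ; homo = λ _ _ → Q.≈ᴹ-refl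
              }
            ; ε-homo = Q.≈ᴹ-refl
            }
          ; ⁻¹-homo = λ _ → Q.≈ᴹ-refl
          }
        ; *ₗ-homo = λ _ _ → Q.≈ᴹ-refl
        }
      }
      where module Q = LeftModule _/_

  twoTorsion : Submodule M ℓm
  twoTorsion = record
    { Member = λ u → u +ᴹ u ≈ᴹ 0ᴹ
    ; resp = λ p q → ≈ᴹ-trans (≈ᴹ-sym (+ᴹ-cong p p)) q
    ; 0-closed = +ᴹ-identityˡ 0ᴹ
    ; +-closed = λ {u} {v} p q → begin
        (u +ᴹ v) +ᴹ (u +ᴹ v) ≈⟨ S.solve 2 (λ u v →
            (u S.⊕ v) S.⊕ (u S.⊕ v) S.⊜ (u S.⊕ u) S.⊕ (v S.⊕ v)) ≈ᴹ-refl u v ⟩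
        (u +ᴹ u) +ᴹ (v +ᴹ v) ≈⟨ +ᴹ-cong p q ⟩
        0ᴹ +ᴹ 0ᴹ             ≈⟨ +ᴹ-identityˡ 0ᴹ ⟩
        0ᴹ                   ∎
    ; neg-closed = λ {u} p → begin
        -ᴹ u +ᴹ -ᴹ u ≈⟨ MP.⁻¹-∙-comm u u ⟩
        -ᴹ (u +ᴹ u)  ≈⟨ -ᴹ‿cong p ⟩
        -ᴹ 0ᴹ        ≈⟨ MP.ε⁻¹≈ε ⟩
        0ᴹ           ∎
    ; *-closed = λ a {u} p → begin
        a *ₗ u +ᴹ a *ₗ u ≈⟨ *ₗ-distribˡ a u u ⟨
        a *ₗ (u +ᴹ u)    ≈⟨ *ₗ-congˡ p ⟩
        a *ₗ 0ᴹ          ≈⟨ *ₗ-zeroʳ a ⟩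
        0ᴹ               ∎
    }
    where module S = CommutativeMonoidSolver +ᴹ-commutativeMonoid

  module _ {i} {I : Set i} (g : I → Carrierᴹ) where

    data Span : Carrierᴹ → Set (r ⊔ m ⊔ ℓm ⊔ i) where
      generator : ∀ k → Span (g k)
      resp      : ∀ {u v} → u ≈ᴹ v → Span u → Span v
      0-closed  : Span 0ᴹ
      +-closed  : ∀ {u v} → Span u → Span v → Span (u +ᴹ v)
      neg-closed  : ∀ {u} → Span u → Span (-ᴹ u)
      *-closed  : ∀ a {u} → Span u → Span (a *ₗ u)

    span : Submodule M (r ⊔ m ⊔ ℓm ⊔ i)
    span = record
      { Member = Span
      ; resp = resp
      ; 0-closed = 0-closed
      ; +-closed = +-closed
      ; neg-closed = neg-closed
      ; *-closed = *-closed
      }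

  module _ where
    open Sum +ᴹ-commutativeMonoid using (sum)

    LinearlyIndependent : ∀ {k} → Vector Carrierᴹ k → Set (r ⊔ ℓr ⊔ ℓm)
    LinearlyIndependent {k} v =
      ∀ (a : Vector R.Carrier k) → sum (λ i → a i *ₗ v i) ≈ᴹ 0ᴹ → ∀ i → a i R.≈ R.0#

    record Basis (n : ℕ) : Set (r ⊔ ℓr ⊔ m ⊔ ℓm) where
      field
        vector      : Vector Carrierᴹ n
        independent : LinearlyIndependent vector
        spanning    : ∀ v → ∃ λ (a : Vector R.Carrier n) → v ≈ᴹ sum (λ i → a i *ₗ vector i)

  GL : Set (r ⊔ m ⊔ ℓm)
  GL = Σ (Carrierᴹ → Carrierᴹ) (IsLeftModuleIsomorphism rawLeftModule rawLeftModule)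

module _ {r ℓr a ℓa b ℓb} {R : Ring r ℓr} {M : LeftModule R a ℓa} {N : LeftModule R b ℓb} where
  private
    module M = LeftModule M
    module N = LeftModule N

  kernel : LinearMap M N → Submodule M ℓb
  kernel f = record
    { Member = λ u → ⟦ u ⟧ N.≈ᴹ N.0ᴹ
    ; resp = λ p q → N.≈ᴹ-trans (N.≈ᴹ-sym (⟦⟧-cong p)) q
    ; 0-closed = 0ᴹ-homo
    ; +-closed = λ p q → N.≈ᴹ-trans (+ᴹ-homo _ _) (N.≈ᴹ-trans (N.+ᴹ-cong p q) (N.+ᴹ-identityˡ N.0ᴹ))
    ; neg-closed = λ p → N.≈ᴹ-trans (-ᴹ-homo _) (N.≈ᴹ-trans (N.-ᴹ‿cong p) NP.ε⁻¹≈ε)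
    ; *-closed = λ a p → N.≈ᴹ-trans (*ₗ-homo a _) (N.≈ᴹ-trans (N.*ₗ-congˡ p) (N.*ₗ-zeroʳ a))
    }
    where
    open LinearMap f
    module NP = AbelianGroupProperties N.+ᴹ-abelianGroup

-- The free R-module on a setoid: the abelian group generated by symbols
-- (a , x), standing for a[x], subject to (a + b)[x] = a[x] + b[x].

module FreeModule {r ℓr x ℓx} (R : Ring r ℓr) (X : Setoid x ℓx) where
  private
    module R = Ring R
    module X = Setoid X

  data _∼_ : Rel (Word (R.Carrier × X.Carrier)) (r ⊔ ℓr ⊔ x ⊔ ℓx) where
    cong    : ∀ {a b x y} → a R.≈ b → x X.≈ y → [ a , x ] ∼ [ b , y ]
    distrib : ∀ a b x → [ a R.+ b , x ] ∼ ([ a , x ] +ʷ [ b , x ])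

  open Presentation _∼_ using (extend; extend-cong; relation; transʷ)

  private
    _·_ : R.Carrier → R.Carrier × X.Carrier → R.Carrier × X.Carrier
    a · (b , x) = a R.* b , x

  freeModule : LeftModule R (r ⊔ x) (r ⊔ ℓr ⊔ x ⊔ ℓx)
  freeModule = ScaledPresentation.leftModule R _∼_ _·_
    (λ { a (cong p q) → relation (cong (R.*-congˡ p) q)
       ; a (distrib b c x) →
           transʷ (relation (cong (R.distribˡ a b c) X.refl)) (relation (distrib _ _ x)) })
    (λ _ p → relation (cong (R.*-congʳ p) X.refl))
    (λ a b (c , x) → transʷ (relation (cong (R.distribʳ c a b) X.refl)) (relation (distrib _ _ x)))
    (λ a b (c , _) → relation (cong (R.*-assoc a b c) X.refl))
    (λ (c , _) → relation (cong (R.*-identityˡ c) X.refl))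

  basis : X.Carrier → LeftModule.Carrierᴹ freeModule
  basis x = [ R.1# , x ]

  module _ {m ℓm} (M : LeftModule R m ℓm) where
    open LeftModule M

    linearExtension : (f : X.Carrier → Carrierᴹ) → (∀ {x y} → x X.≈ y → f x ≈ᴹ f y) →
                      LinearMap freeModule M
    linearExtension f f-cong = record
      { ⟦_⟧ = ext
      ; isLeftModuleHomomorphism = record
        { +ᴹ-isGroupHomomorphism = GroupHomomorphism.isGroupHomomorphism
            (Presentation.extendHom _∼_ +ᴹ-abelianGroup (λ (a , x) → a *ₗ f x) respects)
        ; *ₗ-homo = homo
        }
      }
      where
      module MP = AbelianGroupProperties +ᴹ-abelianGroup
      ext = extend +ᴹ-abelianGroup (λ (a , x) → a *ₗ f x)

      respects : ∀ {u v} → u ∼ v → ext u ≈ᴹ ext v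
      respects (cong p q)      = *ₗ-cong p (f-cong q)
      respects (distrib a b x) = *ₗ-distribʳ (f x) a b

      homo : ∀ a u → ext (mapʷ (a ·_) u) ≈ᴹ a *ₗ ext u
      homo a [ b , x ]  = *ₗ-assoc a b (f x)
      homo a 0ʷ         = ≈ᴹ-sym (*ₗ-zeroʳ a)
      homo a (u +ʷ v)   = ≈ᴹ-trans (+ᴹ-cong (homo a u) (homo a v)) (≈ᴹ-sym (*ₗ-distribˡ a _ _))
      homo a (-ʷ u)     = ≈ᴹ-trans (-ᴹ‿cong (homo a u)) (≈ᴹ-sym (MP.inverseˡ-unique _ _
        (≈ᴹ-trans (≈ᴹ-sym (*ₗ-distribˡ a _ _)) (≈ᴹ-trans (*ₗ-congˡ (-ᴹ‿inverseˡ _)) (*ₗ-zeroʳ a)))))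

-- M ⊗_ℤ B, an R-module via the left factor.

module Tensor {r ℓr m ℓm b ℓb} {R : Ring r ℓr} (M : LeftModule R m ℓm) (B : AbelianGroup b ℓb) where
  private
    module R = Ring R
    module M = LeftModule M
    module B = AbelianGroup B

  data _∼_ : Rel (Word (M.Carrierᴹ × B.Carrier)) (m ⊔ ℓm ⊔ b ⊔ ℓb) where
    cong     : ∀ {u v x y} → u M.≈ᴹ v → x B.≈ y → [ u , x ] ∼ [ v , y ]
    distribʳ : ∀ u v x → [ u M.+ᴹ v , x ] ∼ ([ u , x ] +ʷ [ v , x ])
    distribˡ : ∀ u x y → [ u , x B.∙ y ] ∼ ([ u , x ] +ʷ [ u , y ])

  open Presentation _∼_ using (relation; transʷ)

  private
    _·_ : R.Carrier → M.Carrierᴹ × B.Carrier → M.Carrierᴹ × B.Carrier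
    a · (u , x) = a M.*ₗ u , x

  tensor : LeftModule R (m ⊔ b) (m ⊔ ℓm ⊔ b ⊔ ℓb)
  tensor = ScaledPresentation.leftModule R _∼_ _·_
    (λ { a (cong p q) → relation (cong (M.*ₗ-congˡ p) q)
       ; a (distribʳ u v x) →
           transʷ (relation (cong (M.*ₗ-distribˡ a u v) B.refl)) (relation (distribʳ _ _ x))
       ; a (distribˡ u x y) → relation (distribˡ _ x y) })
    (λ _ p → relation (cong (M.*ₗ-congʳ p) B.refl))
    (λ a b (u , x) → transʷ (relation (cong (M.*ₗ-distribʳ u a b) B.refl)) (relation (distribʳ _ _ x)))
    (λ a b (u , _) → relation (cong (M.*ₗ-assoc a b u) B.refl))
    (λ (u , _) → relation (cong (M.*ₗ-identityˡ u) B.refl))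

  infix 7 _⊗_

  _⊗_ : M.Carrierᴹ → B.Carrier → LeftModule.Carrierᴹ tensor
  u ⊗ x = [ u , x ]

  private
    module T = LeftModule tensor

  ⊗-cong : ∀ {u v x y} → u M.≈ᴹ v → x B.≈ y → u ⊗ x T.≈ᴹ v ⊗ y
  ⊗-cong p q = relation (cong p q)

  ⊗-distribʳ : ∀ u v x → (u M.+ᴹ v) ⊗ x T.≈ᴹ (u ⊗ x) T.+ᴹ (v ⊗ x)
  ⊗-distribʳ u v x = relation (distribʳ u v x)

  ⊗-distribˡ : ∀ u x y → u ⊗ (x B.∙ y) T.≈ᴹ (u ⊗ x) T.+ᴹ (u ⊗ y)
  ⊗-distribˡ u x y = relation (distribˡ u x y)

module _ {g ℓg} (G : AbelianGroup g ℓg) where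
  open AbelianGroup G
  private
    module S = CommutativeMonoidSolver commutativeMonoid
    open AbelianGroupProperties G
    open SetoidReasoning setoid

  ratio-scale : ∀ k a b x y →
    ((k ∙ a) ∙ (k ∙ b)) ∙ ((k ∙ x) ∙ (k ∙ y)) ⁻¹ ≈ (a ∙ b) ∙ (x ∙ y) ⁻¹
  ratio-scale k a b x y = begin
    ((k ∙ a) ∙ (k ∙ b)) ∙ ((k ∙ x) ∙ (k ∙ y)) ⁻¹
      ≈⟨ ∙-cong (pull a b) (trans (⁻¹-cong (pull x y)) (sym (⁻¹-∙-comm _ _))) ⟩
    ((k ∙ k) ∙ (a ∙ b)) ∙ ((k ∙ k) ⁻¹ ∙ (x ∙ y) ⁻¹)
      ≈⟨ S.solve 4 (λ p q r s → (p S.⊕ q) S.⊕ (r S.⊕ s) S.⊜ (p S.⊕ r) S.⊕ (q S.⊕ s)) refl _ _ _ _ ⟩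
    ((k ∙ k) ∙ (k ∙ k) ⁻¹) ∙ ((a ∙ b) ∙ (x ∙ y) ⁻¹)
      ≈⟨ trans (∙-congʳ (inverseʳ _)) (identityˡ _) ⟩
    (a ∙ b) ∙ (x ∙ y) ⁻¹ ∎
    where
    pull : ∀ a b → (k ∙ a) ∙ (k ∙ b) ≈ (k ∙ k) ∙ (a ∙ b)
    pull a b = S.solve 3 (λ k a b → (k S.⊕ a) S.⊕ (k S.⊕ b) S.⊜ (k S.⊕ k) S.⊕ (a S.⊕ b)) refl k a b

module Antisymmetrisation {u ℓu g ℓg} (U : AbelianGroup u ℓu) (G : AbelianGroup g ℓg) where
  private
    module U = AbelianGroup U
    open AbelianGroup G
    open AbelianGroupProperties G
    open SetoidReasoning setoid

  module Biadditive
           (B : U.Carrier → U.Carrier → Carrier)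
           (B-distribˡ : ∀ x y z → B x (y U.∙ z) ≈ B x y ∙ B x z)
           (B-distribʳ : ∀ x y z → B (x U.∙ y) z ≈ B x z ∙ B y z) where

    bracket : U.Carrier → U.Carrier → Carrier
    bracket x y = B x y ∙ B y x ⁻¹

    cyclic : U.Carrier → U.Carrier → U.Carrier → Carrier
    cyclic x y z = bracket z x ∙ (bracket x y ∙ (bracket y z ∙ ε))

    private
      module S = CommutativeMonoidSolver commutativeMonoid

    bracket-scale : ∀ k x y →
      bracket (k U.∙ x) (k U.∙ y) ≈ bracket x y ∙ (bracket k y ∙ bracket k x ⁻¹)
    bracket-scale k x y = begin
      B (k U.∙ x) (k U.∙ y) ∙ B (k U.∙ y) (k U.∙ x) ⁻¹
        ≈⟨ ∙-cong (expand x y) (⁻¹-cong (expand y x)) ⟩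
      ((B k k ∙ B k y) ∙ (B x k ∙ B x y)) ∙ ((B k k ∙ B k x) ∙ (B y k ∙ B y x)) ⁻¹
        ≈⟨ ∙-congˡ (trans (∙-cong (⁻¹-∙-comm _ _) (⁻¹-∙-comm _ _)) (⁻¹-∙-comm _ _)) ⟨
      ((B k k ∙ B k y) ∙ (B x k ∙ B x y)) ∙ ((B k k ⁻¹ ∙ B k x ⁻¹) ∙ (B y k ⁻¹ ∙ B y x ⁻¹))
        ≈⟨ S.solve 8 (λ kk ky xk xy kk′ kx′ yk′ yx′ →
             ((kk S.⊕ ky) S.⊕ (xk S.⊕ xy)) S.⊕ ((kk′ S.⊕ kx′) S.⊕ (yk′ S.⊕ yx′))
             S.⊜ (kk S.⊕ kk′) S.⊕ ((xy S.⊕ yx′) S.⊕ ((ky S.⊕ yk′) S.⊕ (xk S.⊕ kx′))))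
           refl _ _ _ _ _ _ _ _ ⟩
      (B k k ∙ B k k ⁻¹) ∙ (bracket x y ∙ (bracket k y ∙ bracket x k))
        ≈⟨ trans (∙-congʳ (inverseʳ _)) (identityˡ _) ⟩
      bracket x y ∙ (bracket k y ∙ bracket x k)
        ≈⟨ ∙-congˡ (∙-congˡ (⁻¹-anti-homo‿- _ _)) ⟨
      bracket x y ∙ (bracket k y ∙ bracket k x ⁻¹) ∎
      where
      expand : ∀ x y → B (k U.∙ x) (k U.∙ y) ≈ (B k k ∙ B k y) ∙ (B x k ∙ B x y)
      expand x y = trans (B-distribʳ k x (k U.∙ y)) (∙-cong (B-distribˡ k k y) (B-distribˡ x k y))

    cyclic-scale : ∀ k x y z → cyclic (k U.∙ x) (k U.∙ y) (k U.∙ z) ≈ cyclic x y z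
    cyclic-scale k x y z = begin
      cyclic (k U.∙ x) (k U.∙ y) (k U.∙ z)
        ≈⟨ ∙-cong (bracket-scale k z x)
             (∙-cong (bracket-scale k x y) (∙-cong (bracket-scale k y z) refl)) ⟩
      (bracket z x ∙ (X ∙ Z ⁻¹)) ∙ ((bracket x y ∙ (Y ∙ X ⁻¹)) ∙ ((bracket y z ∙ (Z ∙ Y ⁻¹)) ∙ ε))
        ≈⟨ S.solve 9 (λ zx xy yz X Y Z X′ Y′ Z′ →
             (zx S.⊕ (X S.⊕ Z′)) S.⊕ ((xy S.⊕ (Y S.⊕ X′)) S.⊕ ((yz S.⊕ (Z S.⊕ Y′)) S.⊕ S.id))
             S.⊜ (zx S.⊕ (xy S.⊕ (yz S.⊕ S.id))) S.⊕ ((X S.⊕ X′) S.⊕ ((Y S.⊕ Y′) S.⊕ (Z S.⊕ Z′))))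
           refl _ _ _ X Y Z (X ⁻¹) (Y ⁻¹) (Z ⁻¹) ⟩
      cyclic x y z ∙ ((X ∙ X ⁻¹) ∙ ((Y ∙ Y ⁻¹) ∙ (Z ∙ Z ⁻¹)))
        ≈⟨ ∙-congˡ (∙-cong (inverseʳ X) (∙-cong (inverseʳ Y) (inverseʳ Z))) ⟩
      cyclic x y z ∙ (ε ∙ (ε ∙ ε))
        ≈⟨ ∙-congˡ (trans (identityˡ _) (identityˡ ε)) ⟩
      cyclic x y z ∙ ε
        ≈⟨ identityʳ _ ⟩
      cyclic x y z ∎
      where
      X = bracket k x
      Y = bracket k y
      Z = bracket k z

record Field c ℓ : Set (lsuc (c ⊔ ℓ)) where
  field
    commutativeRing : CommutativeRing c ℓ
  open CommutativeRing commutativeRing public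
  field
    1≉0        : 1# ≉ 0#
    invertible : ∀ x → x ≉ 0# → ∃ λ y → x * y ≈ 1#

VectorSpace : ∀ {c ℓ} → Field c ℓ → ∀ m ℓm → Set (c ⊔ ℓ ⊔ lsuc (m ⊔ ℓm))
VectorSpace F m ℓm = LeftModule (Field.ring F) m ℓm

record Derivation {c ℓ} (F : Field c ℓ) : Set (c ⊔ ℓ) where
  open Field F
  field
    D      : Carrier → Carrier
    D-cong : ∀ {a b} → a ≈ b → D a ≈ D b
    D-+    : ∀ a b → D (a + b) ≈ D a + D b
    D-*    : ∀ a b → D (a * b) ≈ a * D b + b * D a

record AlternatingForm {c ℓ m ℓm} (F : Field c ℓ) (V : VectorSpace F m ℓm) : Set (c ⊔ ℓ ⊔ m ⊔ ℓm) where
  open Field F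
  open LeftModule V
  field
    ω      : Carrierᴹ → Carrierᴹ → Carrier
    ω-cong : ∀ {u u′ v v′} → u ≈ᴹ u′ → v ≈ᴹ v′ → ω u v ≈ ω u′ v′
    +-homoˡ : ∀ u u′ v → ω (u +ᴹ u′) v ≈ ω u v + ω u′ v
    *-homoˡ : ∀ a u v → ω (a *ₗ u) v ≈ a * ω u v
    +-homoʳ : ∀ u v v′ → ω u (v +ᴹ v′) ≈ ω u v + ω u v′
    *-homoʳ : ∀ a u v → ω u (a *ₗ v) ≈ a * ω u v
    alternating : ∀ v → ω v v ≈ 0#

-- An element of det V* = Λ²V* is an alternating bilinear form, with
-- ω u v = ⟨ω , u ∧ v⟩; a volume form is a nonzero one.

record VolumeForm {c ℓ m ℓm} (F : Field c ℓ) (V : VectorSpace F m ℓm) : Set (c ⊔ ℓ ⊔ m ⊔ ℓm) where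
  open Field F
  field
    form    : AlternatingForm F V
  open AlternatingForm form public
  field
    nonzero : ¬ (∀ u v → ω u v ≈ 0#)

module FieldConstructions {c ℓ} (F : Field c ℓ) where
  open Field F
  private
    module RP = RingProperties ring
    open SetoidReasoning setoid

  *-≉0 : ∀ {x y} → x ≉ 0# → y ≉ 0# → x * y ≉ 0#
  *-≉0 {x} {y} x≉0 y≉0 xy≈0 = y≉0 (begin
    y              ≈⟨ *-identityˡ y ⟨
    1# * y         ≈⟨ *-congʳ (trans (*-comm x′ x) xx′≈1) ⟨
    (x′ * x) * y   ≈⟨ *-assoc x′ x y ⟩
    x′ * (x * y)   ≈⟨ *-congˡ xy≈0 ⟩
    x′ * 0#        ≈⟨ zeroʳ x′ ⟩
    0#             ∎)
    where
    x′ = proj₁ (invertible x x≉0)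
    xx′≈1 = proj₂ (invertible x x≉0)

  Unit : Set (c ⊔ ℓ)
  Unit = Σ Carrier (_≉ 0#)

  inv : Unit → Carrier
  inv (x , x≉0) = proj₁ (invertible x x≉0)

  inv-inverseʳ : ∀ u → proj₁ u * inv u ≈ 1#
  inv-inverseʳ (x , x≉0) = proj₂ (invertible x x≉0)

  inv-inverseˡ : ∀ u → inv u * proj₁ u ≈ 1#
  inv-inverseˡ u = trans (*-comm _ _) (inv-inverseʳ u)

  inv-unique : ∀ u {y} → proj₁ u * y ≈ 1# → y ≈ inv u
  inv-unique u@(x , _) {y} xy≈1 = begin
    y               ≈⟨ *-identityˡ y ⟨
    1# * y          ≈⟨ *-congʳ (inv-inverseˡ u) ⟨
    (inv u * x) * y ≈⟨ *-assoc _ _ _ ⟩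
    inv u * (x * y) ≈⟨ *-congˡ xy≈1 ⟩
    inv u * 1#      ≈⟨ *-identityʳ _ ⟩
    inv u           ∎

  inv-cong : ∀ u v → proj₁ u ≈ proj₁ v → inv u ≈ inv v
  inv-cong u v p = inv-unique v (trans (*-congʳ (sym p)) (inv-inverseʳ u))

  infixl 7 _÷_

  _÷_ : Carrier → Unit → Carrier
  a ÷ u = a * inv u

  Fˣ : AbelianGroup (c ⊔ ℓ) ℓ
  Fˣ = record
    { Carrier = Unit
    ; _≈_ = λ u v → proj₁ u ≈ proj₁ v
    ; _∙_ = λ (x , x≉0) (y , y≉0) → x * y , *-≉0 x≉0 y≉0
    ; ε = 1# , 1≉0
    ; _⁻¹ = λ u → inv u , λ p →
        1≉0 (trans (sym (inv-inverseʳ u)) (trans (*-congˡ p) (zeroʳ _)))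
    ; isAbelianGroup = record
      { isGroup = record
        { isMonoid = record
          { isSemigroup = record
            { isMagma = record
              { isEquivalence = record { refl = refl ; sym = sym ; trans = trans }
              ; ∙-cong = *-cong
              }
            ; assoc = λ _ _ _ → *-assoc _ _ _
            }
          ; identity = (λ _ → *-identityˡ _) , (λ _ → *-identityʳ _)
          }
        ; inverse = inv-inverseˡ , inv-inverseʳ
        ; ⁻¹-cong = λ {u} {v} → inv-cong u v
        }
      ; comm = λ _ _ → *-comm _ _
      }
    }

  private
    module Fˣ = AbelianGroup Fˣ

  open Tensor (TensorUnit.leftModule {R = ring}) Fˣ public
    using (_⊗_; ⊗-cong; ⊗-distribˡ; ⊗-distribʳ) renaming (tensor to F⊗Fˣ)

  F••-setoid : Setoid (c ⊔ ℓ) ℓ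
  F••-setoid = record
    { Carrier = Σ Carrier (λ a → a ≉ 0# × a ≉ 1#)
    ; _≈_ = λ a b → proj₁ a ≈ proj₁ b
    ; isEquivalence = record { refl = refl ; sym = sym ; trans = trans }
    }

  F•• : Set (c ⊔ ℓ)
  F•• = Setoid.Carrier F••-setoid

  ⌊_⌋ : F•• → Unit
  ⌊ a , a≉0 , _ ⌋ = a , a≉0

  1-_ : F•• → Unit
  1- (a , _ , a≉1) = 1# - a , λ p → a≉1 (sym (RP.x∙y⁻¹≈ε⇒x≈y 1# a p))

  1-cong : ∀ {a b} → a ≈ b → 1# - a ≈ 1# - b
  1-cong p = +-congˡ (-‿cong p)

  private
    module T = LeftModule F⊗Fˣ

  open FreeModule ring F••-setoid using (basis; linearExtension) renaming (freeModule to F[F••]) public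

  δ : LinearMap F[F••] F⊗Fˣ
  δ = linearExtension F⊗Fˣ
    (λ a → proj₁ a ⊗ ⌊ a ⌋ T.+ᴹ proj₁ (1- a) ⊗ (1- a))
    (λ p → T.+ᴹ-cong (⊗-cong p p) (⊗-cong (1-cong p) (1-cong p)))

  β₂ : VectorSpace F (c ⊔ ℓ) (c ⊔ ℓ)
  β₂ = F[F••] / kernel δ

  ⟨_⟩₂ : F•• → LeftModule.Carrierᴹ β₂
  ⟨ a ⟩₂ = basis a

  mod2 : LinearMap F⊗Fˣ (F⊗Fˣ / twoTorsion F⊗Fˣ)
  mod2 = projection _ _

  infix 4 _≈₂_

  _≈₂_ : Rel (LeftModule.Carrierᴹ F⊗Fˣ) (c ⊔ ℓ)
  _≈₂_ = LeftModule._≈ᴹ_ (F⊗Fˣ / twoTorsion F⊗Fˣ)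

module DerivationConstructions {c ℓ} {F : Field c ℓ} (derivation : Derivation F) where
  open Field F
  open FieldConstructions F
  open Derivation derivation
  private
    module RP = RingProperties ring
    module Fˣ = AbelianGroup Fˣ
    module T = LeftModule F⊗Fˣ
    module β₂ = LeftModule β₂
    open SetoidReasoning setoid

  Dlog : Unit → Carrier
  Dlog u = D (proj₁ u) ÷ u

  Dlog-cong : ∀ {u v} → u Fˣ.≈ v → Dlog u ≈ Dlog v
  Dlog-cong {u} {v} p = *-cong (D-cong p) (inv-cong u v p)

  D-1 : D 1# ≈ 0#
  D-1 = RP.x+x≈x⇒x≈0 (D 1#) (begin
    D 1# + D 1#           ≈⟨ +-cong (*-identityˡ _) (*-identityˡ _) ⟨
    1# * D 1# + 1# * D 1# ≈⟨ D-* 1# 1# ⟨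
    D (1# * 1#)           ≈⟨ D-cong (*-identityˡ 1#) ⟩
    D 1#                  ∎)

  D-0 : D 0# ≈ 0#
  D-0 = RP.x+x≈x⇒x≈0 (D 0#) (trans (sym (D-+ 0# 0#)) (D-cong (+-identityˡ 0#)))

  D-neg : ∀ a → D (- a) ≈ - D a
  D-neg a = RP.+-inverseˡ-unique _ _ (begin
    D (- a) + D a ≈⟨ D-+ _ _ ⟨
    D (- a + a)   ≈⟨ D-cong (-‿inverseˡ a) ⟩
    D 0#          ≈⟨ D-0 ⟩
    0#            ∎)

  ⟦_⟧₂ᴰ : F•• → β₂.Carrierᴹ
  ⟦ a ⟧₂ᴰ = (D (proj₁ a) ÷ (⌊ a ⌋ Fˣ.∙ (1- a))) β₂.*ₗ ⟨ a ⟩₂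

  ⟦⟧₂ᴰ-cong : ∀ {a b} → proj₁ a ≈ proj₁ b → ⟦ a ⟧₂ᴰ β₂.≈ᴹ ⟦ b ⟧₂ᴰ
  ⟦⟧₂ᴰ-cong {a} {b} p = LinearMap.⟦⟧-cong (projection _ (kernel δ)) {⟦ a ⟧₂ᴰ} {⟦ b ⟧₂ᴰ}
    (Presentation.relation (FreeModule.cong (*-congʳ (*-cong (D-cong p)
      (inv-cong (⌊ a ⌋ Fˣ.∙ (1- a)) (⌊ b ⌋ Fˣ.∙ (1- b)) (*-cong p (1-cong p))))) p))

  β₂ᴰ : VectorSpace F (c ⊔ ℓ) (c ⊔ ℓ)
  β₂ᴰ = ⟨ span β₂ ⟦_⟧₂ᴰ ⟩

  -- ∂ᴰ is the F-linear extension of the prescribed values on the generators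
  -- ⟦a⟧₂ᴰ; it is well defined because it is the restriction of the injection
  -- β₂ → F ⊗ Fˣ induced by δ.

  ∂-Span : ∀ {u} → Span β₂ ⟦_⟧₂ᴰ u → T.Carrierᴹ
  ∂-Span (generator a)  = (- Dlog (1- a)) ⊗ ⌊ a ⌋ T.+ᴹ Dlog ⌊ a ⌋ ⊗ (1- a)
  ∂-Span (resp _ s)     = ∂-Span s
  ∂-Span 0-closed       = T.0ᴹ
  ∂-Span (+-closed s t) = ∂-Span s T.+ᴹ ∂-Span t
  ∂-Span (neg-closed s) = T.-ᴹ ∂-Span s
  ∂-Span (*-closed a s) = a T.*ₗ ∂-Span s

  private
    module δ = LinearMap δ
    module TP = AbelianGroupProperties T.+ᴹ-abelianGroup

    δ-cong : ∀ {u v} → u β₂.≈ᴹ v → δ.⟦ u ⟧ T.≈ᴹ δ.⟦ v ⟧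
    δ-cong {u} {v} p = TP.x∙y⁻¹≈ε⇒x≈y δ.⟦ u ⟧ δ.⟦ v ⟧ p

    coefficient : F•• → Carrier
    coefficient a = D (proj₁ a) ÷ (⌊ a ⌋ Fˣ.∙ (1- a))

    inv-∙ : ∀ u v → inv (u Fˣ.∙ v) * proj₁ u ≈ inv v
    inv-∙ u v = inv-unique v (begin
      proj₁ v * (inv (u Fˣ.∙ v) * proj₁ u) ≈⟨ *-congˡ (*-comm _ _) ⟩
      proj₁ v * (proj₁ u * inv (u Fˣ.∙ v)) ≈⟨ *-assoc _ _ _ ⟨
      (proj₁ v * proj₁ u) * inv (u Fˣ.∙ v) ≈⟨ *-congʳ (*-comm _ _) ⟩
      (proj₁ u * proj₁ v) * inv (u Fˣ.∙ v) ≈⟨ inv-inverseʳ (u Fˣ.∙ v) ⟩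
      1#                                   ∎)

    D-1- : ∀ a → D (1# - a) ≈ - D a
    D-1- a = begin
      D (1# - a)     ≈⟨ D-+ _ _ ⟩
      D 1# + D (- a) ≈⟨ +-cong D-1 (D-neg a) ⟩
      0# - D a       ≈⟨ +-identityˡ _ ⟩
      - D a          ∎

    coefficient-1 : ∀ a → - Dlog (1- a) ≈ coefficient a * proj₁ a
    coefficient-1 a = begin
      - (D (1# - x) * inv (1- a)) ≈⟨ -‿cong (*-congʳ (D-1- x)) ⟩
      - (- D x * inv (1- a))      ≈⟨ RP.-‿distribˡ-* _ _ ⟩
      - - D x * inv (1- a)        ≈⟨ *-congʳ (RP.-‿involutive _) ⟩
      D x * inv (1- a)            ≈⟨ *-congˡ (inv-∙ ⌊ a ⌋ (1- a)) ⟨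
      D x * (inv (⌊ a ⌋ Fˣ.∙ (1- a)) * x) ≈⟨ *-assoc _ _ _ ⟨
      coefficient a * x           ∎
      where x = proj₁ a

    coefficient-2 : ∀ a → Dlog ⌊ a ⌋ ≈ coefficient a * proj₁ (1- a)
    coefficient-2 a = begin
      D x * inv ⌊ a ⌋ ≈⟨ *-congˡ (inv-∙ (1- a) ⌊ a ⌋) ⟨
      D x * (inv ((1- a) Fˣ.∙ ⌊ a ⌋) * y) ≈⟨ *-congˡ (*-congʳ
        (inv-cong ((1- a) Fˣ.∙ ⌊ a ⌋) (⌊ a ⌋ Fˣ.∙ (1- a)) (*-comm _ _))) ⟩
      D x * (inv (⌊ a ⌋ Fˣ.∙ (1- a)) * y) ≈⟨ *-assoc _ _ _ ⟨
      coefficient a * y ∎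
      where
      x = proj₁ a
      y = proj₁ (1- a)

    ∂≈δ : ∀ {u} (s : Span β₂ ⟦_⟧₂ᴰ u) → ∂-Span s T.≈ᴹ δ.⟦ u ⟧
    ∂≈δ (generator a)  = T.≈ᴹ-trans
      (T.+ᴹ-cong (⊗-cong (trans (coefficient-1 a) (*-congʳ (sym (*-identityʳ _)))) refl)
                 (⊗-cong (trans (coefficient-2 a) (*-congʳ (sym (*-identityʳ _)))) refl))
      T.≈ᴹ-refl
    ∂≈δ (resp {u} {v} p s) = T.≈ᴹ-trans (∂≈δ s) (δ-cong {u} {v} p)
    ∂≈δ 0-closed       = T.≈ᴹ-refl
    ∂≈δ (+-closed s t) = T.+ᴹ-cong (∂≈δ s) (∂≈δ t)
    ∂≈δ (neg-closed s) = T.-ᴹ‿cong (∂≈δ s)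
    ∂≈δ (*-closed a {u} s) = T.≈ᴹ-trans (T.*ₗ-congˡ {a} (∂≈δ s)) (T.≈ᴹ-sym (δ.*ₗ-homo a u))

  ∂ᴰ : LinearMap β₂ᴰ F⊗Fˣ
  ∂ᴰ = record
    { ⟦_⟧ = λ (_ , s) → ∂-Span s
    ; isLeftModuleHomomorphism = record
      { +ᴹ-isGroupHomomorphism = record
        { isMonoidHomomorphism = record
          { isMagmaHomomorphism = record
            { isRelHomomorphism = record
              { cong = λ { {u , s} {v , t} p →
                  T.≈ᴹ-trans (∂≈δ s) (T.≈ᴹ-trans (δ-cong {u} {v} p) (T.≈ᴹ-sym (∂≈δ t))) } }
            ; homo = λ _ _ → T.≈ᴹ-refl
            }
          ; ε-homo = T.≈ᴹ-refl
          }
        ; ⁻¹-homo = λ _ → T.≈ᴹ-refl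
        }
      ; *ₗ-homo = λ _ _ → T.≈ᴹ-refl
      }
    }

module Configurations {c ℓ m ℓm} {F : Field c ℓ} (V : VectorSpace F m ℓm) where
  open LeftModule V

  record GenericTuple (n : ℕ) : Set (c ⊔ ℓ ⊔ m ⊔ ℓm) where
    field
      vector  : Vector Carrierᴹ n
      generic : ∀ {k} → k ℕ.≤ 2 → (s : Fin k → Fin n) → Injective _≡_ _≡_ s →
                LinearlyIndependent V (vector ∘ s)

  open GenericTuple public

  data _∼_ {n} : Rel (Word (GenericTuple n)) (c ⊔ ℓ ⊔ m ⊔ ℓm) where
    orbit : ∀ l l′ (g : GL V) → (∀ i → proj₁ g (vector l i) ≈ᴹ vector l′ i) → [ l ] ∼ [ l′ ]

  C : ℕ → AbelianGroup (c ⊔ ℓ ⊔ m ⊔ ℓm) (c ⊔ ℓ ⊔ m ⊔ ℓm)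
  C n = Presentation.abelianGroup (_∼_ {n})

  omit : ∀ {n} → Fin (suc n) → GenericTuple (suc n) → GenericTuple n
  omit i l = record
    { vector  = vector l ∘ punchIn i
    ; generic = λ k≤2 s s-inj → generic l k≤2 (punchIn i ∘ s) (s-inj ∘ punchIn-injective i _ _)
    }

  infixr 8 [-1]^_∙_

  [-1]^_∙_ : ∀ {n} → ℕ → AbelianGroup.Carrier (C n) → AbelianGroup.Carrier (C n)
  [-1]^ zero ∙ u  = u
  [-1]^ suc k ∙ u = -ʷ ([-1]^ k ∙ u)

  face : ∀ {n} → GenericTuple (suc n) → AbelianGroup.Carrier (C n)
  face {n} l = sum (λ i → [-1]^ toℕ i ∙ [ omit i l ])
    where open Sum (AbelianGroup.commutativeMonoid (C n)) using (sum)

  d : ∀ {n} → GroupHomomorphism (AbelianGroup.rawGroup (C (suc n))) (AbelianGroup.rawGroup (C n))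
  d {n} = Presentation.extendHom _∼_ (C n) face respects
    where
    open Presentation (_∼_ {n}) using (_≈ʷ_; relation; -ʷ‿cong)
    open Sum (AbelianGroup.commutativeMonoid (C n)) using (sum-cong-≋)

    sign-cong : ∀ k {u v} → u ≈ʷ v → [-1]^ k ∙ u ≈ʷ [-1]^ k ∙ v
    sign-cong zero    p = p
    sign-cong (suc k) p = -ʷ‿cong (sign-cong k p)

    respects : ∀ {u v} → u ∼ v →
               Presentation.extend _∼_ (C n) face u ≈ʷ Presentation.extend _∼_ (C n) face v
    respects (orbit l l′ g p) = sum-cong-≋ (λ i →
      sign-cong (toℕ i) (relation (orbit (omit i l) (omit i l′) g (p ∘ punchIn i))))

module PlaneForm {c ℓ m ℓm} {F : Field c ℓ} {V : VectorSpace F m ℓm}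
                 (e : Basis V 2) (A : AlternatingForm F V) where
  open Field F
  open LeftModule V
  open AlternatingForm A
  open Basis e using (vector; spanning)
  private
    module RP = RingProperties ring
    module S = SemiringSolver commutativeSemiring

    e₀ = vector 0F
    e₁ = vector 1F
    w = ω e₀ e₁

    n : Carrier
    n = - 1#

    neg≈n* : ∀ a → - a ≈ n * a
    neg≈n* a = sym (RP.-1*x≈-x a)

    vanish : ∀ a → (1# + n) * a ≈ 0#
    vanish a = trans (*-congʳ (-‿inverseʳ 1#)) (zeroˡ a)

    x₀ x₁ : Carrierᴹ → Carrier
    x₀ x = proj₁ (spanning x) 0F
    x₁ x = proj₁ (spanning x) 1F

    combination : Carrier → Carrier → Carrierᴹ
    combination a b = a *ₗ e₀ +ᴹ b *ₗ e₁

    decompose : ∀ x → x ≈ᴹ combination (x₀ x) (x₁ x)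
    decompose x = ≈ᴹ-trans (proj₂ (spanning x)) (+ᴹ-congˡ (+ᴹ-identityʳ _))

  minor : Carrierᴹ → Carrierᴹ → Carrier
  minor x y = x₀ x * x₁ y + n * (x₁ x * x₀ y)

  antisymmetric : ∀ x y → ω y x ≈ - ω x y
  antisymmetric x y = RP.+-inverseˡ-unique _ _ (begin
    ω y x + ω x y                       ≈⟨ +-cong (+-identityˡ _) (+-identityʳ _) ⟨
    (0# + ω y x) + (ω x y + 0#)         ≈⟨ +-cong (+-congʳ (alternating x)) (+-congˡ (alternating y)) ⟨
    (ω x x + ω y x) + (ω x y + ω y y)   ≈⟨ +-cong (+-homoˡ x y x) (+-homoˡ x y y) ⟨
    ω (x +ᴹ y) x + ω (x +ᴹ y) y         ≈⟨ +-homoʳ (x +ᴹ y) x y ⟨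
    ω (x +ᴹ y) (x +ᴹ y)                 ≈⟨ alternating (x +ᴹ y) ⟩
    0#                                  ∎)
    where open SetoidReasoning setoid

  private
    expandʳ : ∀ x a b → ω x (combination a b) ≈ a * ω x e₀ + b * ω x e₁
    expandʳ x a b = trans (+-homoʳ x _ _) (+-cong (*-homoʳ a x e₀) (*-homoʳ b x e₁))

    expandˡ : ∀ a b y → ω (combination a b) y ≈ a * ω e₀ y + b * ω e₁ y
    expandˡ a b y = trans (+-homoˡ _ _ y) (+-cong (*-homoˡ a e₀ y) (*-homoˡ b e₁ y))

  ω≈minor : ∀ x y → ω x y ≈ minor x y * w
  ω≈minor x y = begin
    ω x y ≈⟨ ω-cong (decompose x) (decompose y) ⟩
    ω (combination a b) (combination c′ d′) ≈⟨ expandˡ a b _ ⟩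
    a * ω e₀ (combination c′ d′) + b * ω e₁ (combination c′ d′)
      ≈⟨ +-cong (*-congˡ (expandʳ e₀ c′ d′)) (*-congˡ (expandʳ e₁ c′ d′)) ⟩
    a * (c′ * ω e₀ e₀ + d′ * w) + b * (c′ * ω e₁ e₀ + d′ * ω e₁ e₁)
      ≈⟨ +-cong (*-congˡ (+-congʳ (*-congˡ (alternating e₀))))
                (*-congˡ (+-cong (*-congˡ (trans (antisymmetric e₀ e₁) (neg≈n* w)))
                                 (*-congˡ (alternating e₁)))) ⟩
    a * (c′ * 0# + d′ * w) + b * (c′ * (n * w) + d′ * 0#)
      ≈⟨ S.solve 6 (λ a b c d n w →
           a S.:* (c S.:* S.con 0 S.:+ d S.:* w) S.:+ b S.:* (c S.:* (n S.:* w) S.:+ d S.:* S.con 0)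
           S.:= (a S.:* d S.:+ n S.:* (b S.:* c)) S.:* w) refl a b c′ d′ n w ⟩
    minor x y * w ∎
    where
    open SetoidReasoning setoid
    a = x₀ x
    b = x₁ x
    c′ = x₀ y
    d′ = x₁ y

  nondegenerate : ¬ (∀ u v → ω u v ≈ 0#) → w ≉ 0#
  nondegenerate nz w≈0 = nz (λ u v → trans (ω≈minor u v) (trans (*-congˡ w≈0) (zeroʳ _)))

  cramer : ∀ x y z → ω x y *ₗ z ≈ᴹ ω z y *ₗ x +ᴹ ω x z *ₗ y
  cramer x y z = ≈ᴹ-sym (begin
    ω z y *ₗ x +ᴹ ω x z *ₗ y
      ≈⟨ +ᴹ-cong (scale (ω z y) x) (scale (ω x z) y) ⟩
    combination (ω z y * x₀ x) (ω z y * x₁ x) +ᴹ combination (ω x z * x₀ y) (ω x z * x₁ y)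
      ≈⟨ add _ _ _ _ ⟩
    combination (ω z y * x₀ x + ω x z * x₀ y) (ω z y * x₁ x + ω x z * x₁ y)
      ≈⟨ +ᴹ-cong (*ₗ-congʳ eq₀) (*ₗ-congʳ eq₁) ⟩
    combination (ω x y * x₀ z) (ω x y * x₁ z)
      ≈⟨ scale (ω x y) z ⟨
    ω x y *ₗ z ∎)
    where
    open SetoidReasoning ≈ᴹ-setoid
    module SM = CommutativeMonoidSolver +ᴹ-commutativeMonoid

    scale : ∀ a u → a *ₗ u ≈ᴹ combination (a * x₀ u) (a * x₁ u)
    scale a u = ≈ᴹ-trans (*ₗ-congˡ (decompose u)) (≈ᴹ-trans (*ₗ-distribˡ a _ _)
      (+ᴹ-cong (≈ᴹ-sym (*ₗ-assoc a _ _)) (≈ᴹ-sym (*ₗ-assoc a _ _))))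

    add : ∀ a b a′ b′ → combination a b +ᴹ combination a′ b′ ≈ᴹ combination (a + a′) (b + b′)
    add a b a′ b′ = ≈ᴹ-trans
      (SM.solve 4 (λ p q r s → (p SM.⊕ q) SM.⊕ (r SM.⊕ s) SM.⊜ (p SM.⊕ r) SM.⊕ (q SM.⊕ s)) ≈ᴹ-refl _ _ _ _)
      (+ᴹ-cong (≈ᴹ-sym (*ₗ-distribʳ e₀ a a′)) (≈ᴹ-sym (*ₗ-distribʳ e₁ b b′)))

    module R = SetoidReasoning setoid

    eq₀ : ω z y * x₀ x + ω x z * x₀ y ≈ ω x y * x₀ z
    eq₀ = R.begin
      ω z y * x₀ x + ω x z * x₀ y
        R.≈⟨ +-cong (*-congʳ (ω≈minor z y)) (*-congʳ (ω≈minor x z)) ⟩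
      minor z y * w * x₀ x + minor x z * w * x₀ y
        R.≈⟨ S.solve 8 (λ x₀ x₁ y₀ y₁ z₀ z₁ n w →
               (z₀ S.:* y₁ S.:+ n S.:* (z₁ S.:* y₀)) S.:* w S.:* x₀ S.:+
               (x₀ S.:* z₁ S.:+ n S.:* (x₁ S.:* z₀)) S.:* w S.:* y₀
               S.:= (x₀ S.:* y₁ S.:+ n S.:* (x₁ S.:* y₀)) S.:* w S.:* z₀
                    S.:+ (S.con 1 S.:+ n) S.:* (w S.:* (x₀ S.:* (y₀ S.:* z₁))))
             refl (x₀ x) (x₁ x) (x₀ y) (x₁ y) (x₀ z) (x₁ z) n w ⟩
      minor x y * w * x₀ z + (1# + n) * (w * (x₀ x * (x₀ y * x₁ z)))
        R.≈⟨ +-congˡ (vanish _) ⟩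
      minor x y * w * x₀ z + 0#
        R.≈⟨ +-identityʳ _ ⟩
      minor x y * w * x₀ z
        R.≈⟨ *-congʳ (ω≈minor x y) ⟨
      ω x y * x₀ z R.∎

    eq₁ : ω z y * x₁ x + ω x z * x₁ y ≈ ω x y * x₁ z
    eq₁ = R.begin
      ω z y * x₁ x + ω x z * x₁ y
        R.≈⟨ +-cong (*-congʳ (ω≈minor z y)) (*-congʳ (ω≈minor x z)) ⟩
      minor z y * w * x₁ x + minor x z * w * x₁ y
        R.≈⟨ S.solve 8 (λ x₀ x₁ y₀ y₁ z₀ z₁ n w →
               (z₀ S.:* y₁ S.:+ n S.:* (z₁ S.:* y₀)) S.:* w S.:* x₁ S.:+
               (x₀ S.:* z₁ S.:+ n S.:* (x₁ S.:* z₀)) S.:* w S.:* y₁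
               S.:= (x₀ S.:* y₁ S.:+ n S.:* (x₁ S.:* y₀)) S.:* w S.:* z₁
                    S.:+ (S.con 1 S.:+ n) S.:* (w S.:* (x₁ S.:* (y₁ S.:* z₀))))
             refl (x₀ x) (x₁ x) (x₀ y) (x₁ y) (x₀ z) (x₁ z) n w ⟩
      minor x y * w * x₁ z + (1# + n) * (w * (x₁ x * (x₁ y * x₀ z)))
        R.≈⟨ +-congˡ (vanish _) ⟩
      minor x y * w * x₁ z + 0#
        R.≈⟨ +-identityʳ _ ⟩
      minor x y * w * x₁ z
        R.≈⟨ *-congʳ (ω≈minor x y) ⟨
      ω x y * x₁ z R.∎

  plücker : ∀ x y z t → ω x y * ω z t ≈ ω z y * ω x t + ω x z * ω y t
  plücker x y z t = begin
    ω x y * ω z t                          ≈⟨ *-homoˡ _ z t ⟨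
    ω (ω x y *ₗ z) t                       ≈⟨ ω-cong (cramer x y z) ≈ᴹ-refl ⟩
    ω (ω z y *ₗ x +ᴹ ω x z *ₗ y) t         ≈⟨ +-homoˡ _ _ t ⟩
    ω (ω z y *ₗ x) t + ω (ω x z *ₗ y) t    ≈⟨ +-cong (*-homoˡ _ x t) (*-homoˡ _ y t) ⟩
    ω z y * ω x t + ω x z * ω y t          ∎
    where open SetoidReasoning setoid

module Maps {c ℓ m ℓm} {F : Field c ℓ} (derivation : Derivation F)
            {V : VectorSpace F m ℓm} (e : Basis V 2) (volume : VolumeForm F V) where
  open Field F
  open FieldConstructions F
  open Derivation derivation
  open DerivationConstructions derivation
  open Configurations {F = F} V
  open LeftModule V
  open VolumeForm volume
  private
    module RP = RingProperties ring
    module Fˣ = AbelianGroup Fˣ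
    module P = PlaneForm e form

    e₀ = Basis.vector e 0F
    e₁ = Basis.vector e 1F

    ω₀₁≉0 : ω e₀ e₁ ≉ 0#
    ω₀₁≉0 = P.nondegenerate nonzero

    pair-injective : ∀ {n} {i j : Fin n} → i ≢ j → Injective {A = Fin 2} _≡_ _≡_ (i ∷ j ∷ [])
    pair-injective i≢j {0F} {0F} _ = ≡.refl
    pair-injective i≢j {0F} {1F} p = ⊥-elim (i≢j p)
    pair-injective i≢j {1F} {0F} p = ⊥-elim (i≢j (≡.sym p))
    pair-injective i≢j {1F} {1F} _ = ≡.refl

  Δ≉0 : ∀ {n} (l : GenericTuple n) {i j} → i ≢ j → ω (vector l i) (vector l j) ≉ 0#
  Δ≉0 l {i} {j} i≢j ωxy≈0 = ω₀₁≉0 (independent (ω e₀ e₁ ∷ 0# ∷ []) dependence 0F)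
    where
    open SetoidReasoning ≈ᴹ-setoid
    x = vector l i
    y = vector l j

    independent : ∀ (a : Vector Carrier 2) → a 0F *ₗ x +ᴹ (a 1F *ₗ y +ᴹ 0ᴹ) ≈ᴹ 0ᴹ → ∀ k → a k ≈ 0#
    independent = generic l ≤-refl (i ∷ j ∷ []) (λ {a} {b} → pair-injective i≢j {a} {b})

    ωx≈0 : ∀ z → ω x z ≈ 0#
    ωx≈0 z = independent (ω z y ∷ ω x z ∷ []) (begin
      ω z y *ₗ x +ᴹ (ω x z *ₗ y +ᴹ 0ᴹ) ≈⟨ +ᴹ-congˡ (+ᴹ-identityʳ _) ⟩
      ω z y *ₗ x +ᴹ ω x z *ₗ y         ≈⟨ P.cramer x y z ⟨
      ω x y *ₗ z                       ≈⟨ *ₗ-congʳ ωxy≈0 ⟩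
      0# *ₗ z                          ≈⟨ *ₗ-zeroˡ z ⟩
      0ᴹ                               ∎) 1F

    dependence : ω e₀ e₁ *ₗ x +ᴹ (0# *ₗ y +ᴹ 0ᴹ) ≈ᴹ 0ᴹ
    dependence = begin
      ω e₀ e₁ *ₗ x +ᴹ (0# *ₗ y +ᴹ 0ᴹ)      ≈⟨ +ᴹ-congˡ (≈ᴹ-trans (+ᴹ-identityʳ _) (*ₗ-zeroˡ y)) ⟩
      ω e₀ e₁ *ₗ x +ᴹ 0ᴹ                   ≈⟨ +ᴹ-identityʳ _ ⟩
      ω e₀ e₁ *ₗ x                         ≈⟨ P.cramer e₀ e₁ x ⟩
      ω x e₁ *ₗ e₀ +ᴹ ω e₀ x *ₗ e₁         ≈⟨ +ᴹ-cong (*ₗ-congʳ (ωx≈0 e₁)) (*ₗ-congʳ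
        (trans (P.antisymmetric x e₀) (trans (-‿cong (ωx≈0 e₀)) RP.-0#≈0#))) ⟩
      0# *ₗ e₀ +ᴹ 0# *ₗ e₁                 ≈⟨ +ᴹ-cong (*ₗ-zeroˡ e₀) (*ₗ-zeroˡ e₁) ⟩
      0ᴹ +ᴹ 0ᴹ                             ≈⟨ +ᴹ-identityˡ 0ᴹ ⟩
      0ᴹ                                   ∎

  Δ : ∀ {n} (l : GenericTuple n) (i j : Fin n) → i ≢ j → Unit
  Δ l i j i≢j = ω (vector l i) (vector l j) , Δ≉0 l i≢j

  private
    module GLScale {n} {l l′ : GenericTuple n} (g : GL V)
                   (gl≈l′ : ∀ i → proj₁ g (vector l i) ≈ᴹ vector l′ i)
                   {i₀ j₀ : Fin n} (i₀≢j₀ : i₀ ≢ j₀) where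
      open IsLeftModuleIsomorphism (proj₂ g) using (⟦⟧-cong; +ᴹ-homo; *ₗ-homo)
      open SetoidReasoning setoid

      pullback : AlternatingForm F V
      pullback = record
        { ω = λ u v → ω (proj₁ g u) (proj₁ g v)
        ; ω-cong = λ p q → ω-cong (⟦⟧-cong p) (⟦⟧-cong q)
        ; +-homoˡ = λ u u′ v → trans (ω-cong (+ᴹ-homo u u′) ≈ᴹ-refl) (+-homoˡ _ _ _)
        ; *-homoˡ = λ a u v → trans (ω-cong (*ₗ-homo a u) ≈ᴹ-refl) (*-homoˡ a _ _)
        ; +-homoʳ = λ u v v′ → trans (ω-cong ≈ᴹ-refl (+ᴹ-homo v v′)) (+-homoʳ _ _ _)
        ; *-homoʳ = λ a u v → trans (ω-cong ≈ᴹ-refl (*ₗ-homo a v)) (*-homoʳ a _ _)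
        ; alternating = λ v → alternating (proj₁ g v)
        }

      private
        module P′ = PlaneForm e pullback

        w : Unit
        w = ω e₀ e₁ , ω₀₁≉0

        det : Carrier
        det = ω (proj₁ g e₀) (proj₁ g e₁) ÷ w

        scaled : ∀ i j → ω (vector l′ i) (vector l′ j) ≈ det * ω (vector l i) (vector l j)
        scaled i j = begin
          ω (vector l′ i) (vector l′ j) ≈⟨ ω-cong (gl≈l′ i) (gl≈l′ j) ⟨
          ω (proj₁ g x) (proj₁ g y)     ≈⟨ P′.ω≈minor x y ⟩
          μ * w′                        ≈⟨ *-comm _ _ ⟩
          w′ * μ                        ≈⟨ *-congˡ (trans (*-congʳ (inv-inverseˡ w)) (*-identityˡ μ)) ⟨
          w′ * (inv w * ω e₀ e₁ * μ)    ≈⟨ *-congˡ (trans (*-assoc _ _ _) (*-congˡ (*-comm _ _))) ⟩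
          w′ * (inv w * (μ * ω e₀ e₁))  ≈⟨ *-assoc _ _ _ ⟨
          det * (μ * ω e₀ e₁)           ≈⟨ *-congˡ (P.ω≈minor x y) ⟨
          det * ω x y                   ∎
          where
          x = vector l i
          y = vector l j
          w′ = ω (proj₁ g e₀) (proj₁ g e₁)
          μ = P.minor x y

      k : Unit
      k = det , λ det≈0 → Δ≉0 l′ i₀≢j₀ (trans (scaled i₀ j₀) (trans (*-congʳ det≈0) (zeroˡ _)))

      Δ-scale : ∀ i j (i≢j : i ≢ j) → Δ l′ i j i≢j Fˣ.≈ k Fˣ.∙ Δ l i j i≢j
      Δ-scale i j _ = scaled i j

  infixl 6 _⊕_

  _⊕_ : Fin 3 → ℕ → Fin 3
  i ⊕ k = (toℕ i ℕ.+ k) mod 3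

  i≢i⊕1 : ∀ i → i ≢ i ⊕ 1
  i≢i⊕1 0F ()
  i≢i⊕1 1F ()
  i≢i⊕1 2F ()

  i≢i⊕2 : ∀ i → i ≢ i ⊕ 2
  i≢i⊕2 0F ()
  i≢i⊕2 1F ()
  i≢i⊕2 2F ()

  private
    module T = LeftModule F⊗Fˣ
    module T₂ = LeftModule (F⊗Fˣ / twoTorsion F⊗Fˣ)
    module mod2 = LinearMap mod2

  τ₀²-tuple : GenericTuple 3 → T.Carrierᴹ
  τ₀²-tuple l = sum (λ i →
         Dlog (Δ l i (i ⊕ 2) (i≢i⊕2 i)) ⊗ Δ l i (i ⊕ 1) (i≢i⊕1 i)
    T.+ᴹ T.-ᴹ (Dlog (Δ l (i ⊕ 1) i (i≢i⊕1 i ∘ ≡.sym)) ⊗ Δ l i (i ⊕ 2) (i≢i⊕2 i)))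
    where open Sum T.+ᴹ-commutativeMonoid using (sum)

  private
    module TP = AbelianGroupProperties T.+ᴹ-abelianGroup

  B : Unit → Unit → T.Carrierᴹ
  B u v = Dlog u ⊗ v

  Dlog-∙ : ∀ u v → Dlog (u Fˣ.∙ v) ≈ Dlog u + Dlog v
  Dlog-∙ u@(x , _) v@(y , _) = begin
    D (x * y) * inv (u Fˣ.∙ v)                                    ≈⟨ *-congʳ (D-* x y) ⟩
    (x * D y + y * D x) * inv (u Fˣ.∙ v)                          ≈⟨ distribʳ _ _ _ ⟩
    x * D y * inv (u Fˣ.∙ v) + y * D x * inv (u Fˣ.∙ v)           ≈⟨ +-cong (cancel u v _ refl) (cancel v u _ (*-comm y x)) ⟩
    Dlog v + Dlog u                                               ≈⟨ +-comm _ _ ⟩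
    Dlog u + Dlog v                                               ∎
    where
    open SetoidReasoning setoid
    cancel : ∀ u v (uv : Unit) → proj₁ u * proj₁ v ≈ proj₁ uv → proj₁ u * D (proj₁ v) * inv uv ≈ Dlog v
    cancel (x , _) v@(y , _) uv p = begin
      x * D y * inv uv   ≈⟨ *-congʳ (*-comm _ _) ⟩
      D y * x * inv uv   ≈⟨ *-assoc _ _ _ ⟩
      D y * (x * inv uv) ≈⟨ *-congˡ (inv-unique v (begin
        y * (x * inv uv) ≈⟨ *-assoc _ _ _ ⟨
        y * x * inv uv   ≈⟨ *-congʳ (trans (*-comm y x) p) ⟩
        proj₁ uv * inv uv ≈⟨ inv-inverseʳ uv ⟩
        1#               ∎)) ⟩
      D y * inv v        ∎

  B-cong : ∀ {u u′ v v′} → u Fˣ.≈ u′ → v Fˣ.≈ v′ → B u v T₂.≈ᴹ B u′ v′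
  B-cong {u} {u′} {v} {v′} p q = mod2.⟦⟧-cong {B u v} {B u′ v′} (⊗-cong (Dlog-cong {u} {u′} p) q)

  B-distribˡ : ∀ u v w → B u (v Fˣ.∙ w) T₂.≈ᴹ B u v T₂.+ᴹ B u w
  B-distribˡ u v w = mod2.⟦⟧-cong {B u (v Fˣ.∙ w)} {B u v T.+ᴹ B u w} (⊗-distribˡ (Dlog u) v w)

  B-distribʳ : ∀ u v w → B (u Fˣ.∙ v) w T₂.≈ᴹ B u w T₂.+ᴹ B v w
  B-distribʳ u v w = mod2.⟦⟧-cong {B (u Fˣ.∙ v) w} {B u w T.+ᴹ B v w}
    (T.≈ᴹ-trans (⊗-cong (Dlog-∙ u v) refl) (⊗-distribʳ (Dlog u) (Dlog v) w))

  Dlog-neg : ∀ u v → proj₁ v ≈ - proj₁ u → Dlog v ≈ Dlog u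
  Dlog-neg u v p = begin
    D (proj₁ v) * inv v ≈⟨ *-cong (trans (D-cong p) (D-neg _)) inv-neg ⟩
    - D (proj₁ u) * - inv u ≈⟨ RP.-‿distribˡ-* _ _ ⟨
    - (D (proj₁ u) * - inv u) ≈⟨ -‿cong (RP.-‿distribʳ-* _ _) ⟨
    - - (D (proj₁ u) * inv u) ≈⟨ RP.-‿involutive _ ⟩
    D (proj₁ u) * inv u ∎
    where
    open SetoidReasoning setoid
    inv-neg : inv v ≈ - inv u
    inv-neg = sym (inv-unique v (begin
      proj₁ v * - inv u       ≈⟨ *-congʳ p ⟩
      - proj₁ u * - inv u     ≈⟨ RP.-‿distribˡ-* _ _ ⟨
      - (proj₁ u * - inv u)   ≈⟨ -‿cong (RP.-‿distribʳ-* _ _) ⟨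
      - - (proj₁ u * inv u)   ≈⟨ RP.-‿involutive _ ⟩
      proj₁ u * inv u         ≈⟨ inv-inverseʳ u ⟩
      1#                      ∎))

  -- a ⊗ (−u) and a ⊗ u differ by the 2-torsion element a ⊗ (−1).

  ⊗-neg : ∀ a u v → proj₁ v ≈ - proj₁ u → a ⊗ v T₂.≈ᴹ a ⊗ u
  ⊗-neg a u v p = T.≈ᴹ-trans
    (S.solve 2 (λ x y → (x S.⊕ y) S.⊕ (x S.⊕ y) S.⊜ (x S.⊕ x) S.⊕ (y S.⊕ y)) T.≈ᴹ-refl (a ⊗ v) (T.-ᴹ (a ⊗ u)))
    (T.≈ᴹ-trans (T.+ᴹ-cong double (TP.⁻¹-∙-comm (a ⊗ u) (a ⊗ u))) (T.-ᴹ‿inverseʳ (a ⊗ u T.+ᴹ a ⊗ u)))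
    where
    module S = CommutativeMonoidSolver T.+ᴹ-commutativeMonoid
    square : proj₁ v * proj₁ v ≈ proj₁ u * proj₁ u
    square = begin
      proj₁ v * proj₁ v         ≈⟨ *-cong p p ⟩
      - proj₁ u * - proj₁ u     ≈⟨ RP.-‿distribˡ-* _ _ ⟨
      - (proj₁ u * - proj₁ u)   ≈⟨ -‿cong (RP.-‿distribʳ-* _ _) ⟨
      - - (proj₁ u * proj₁ u)   ≈⟨ RP.-‿involutive _ ⟩
      proj₁ u * proj₁ u         ∎
      where open SetoidReasoning setoid
    double : a ⊗ v T.+ᴹ a ⊗ v T.≈ᴹ a ⊗ u T.+ᴹ a ⊗ u
    double = T.≈ᴹ-trans (T.≈ᴹ-sym (⊗-distribˡ a v v))
      (T.≈ᴹ-trans (⊗-cong {x = v Fˣ.∙ v} {y = u Fˣ.∙ u} refl square) (⊗-distribˡ a u u))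

  B-neg : ∀ u u′ v v′ → proj₁ u′ ≈ - proj₁ u → proj₁ v′ ≈ - proj₁ v → B u′ v′ T₂.≈ᴹ B u v
  B-neg u u′ v v′ p q = T₂.≈ᴹ-trans {B u′ v′} {B u v′} {B u v}
    (mod2.⟦⟧-cong {B u′ v′} {B u v′} (⊗-cong (Dlog-neg u u′ p) refl)) (⊗-neg (Dlog u) v v′ q)

  B-negˡ : ∀ u u′ v → proj₁ u′ ≈ - proj₁ u → B u′ v T₂.≈ᴹ B u v
  B-negˡ u u′ v p = mod2.⟦⟧-cong {B u′ v} {B u v} (⊗-cong (Dlog-neg u u′ p) refl)

  private
    module A = Antisymmetrisation Fˣ T₂.+ᴹ-abelianGroup

  open A.Biadditive B B-distribˡ B-distribʳ public using (bracket; cyclic; cyclic-scale)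

  sum₃-cong : ∀ a a′ b b′ c c′ → a T₂.≈ᴹ a′ → b T₂.≈ᴹ b′ → c T₂.≈ᴹ c′ →
              (a T.+ᴹ (b T.+ᴹ (c T.+ᴹ T.0ᴹ))) T₂.≈ᴹ (a′ T.+ᴹ (b′ T.+ᴹ (c′ T.+ᴹ T.0ᴹ)))
  sum₃-cong a a′ b b′ c c′ p q r =
    T₂.+ᴹ-cong {a} {a′} p (T₂.+ᴹ-cong {b} {b′} q (T₂.+ᴹ-cong {c} {c′} r (T₂.≈ᴹ-refl {T.0ᴹ})))

  bracket-cong : ∀ {u u′ v v′} → u Fˣ.≈ u′ → v Fˣ.≈ v′ → bracket u v T₂.≈ᴹ bracket u′ v′
  bracket-cong {u} {u′} {v} {v′} p q =
    T₂.+ᴹ-cong {B u v} {B u′ v′} (B-cong {u} {u′} {v} {v′} p q)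
      (T₂.-ᴹ‿cong {B v u} {B v′ u′} (B-cong {v} {v′} {u} {u′} q p))

  cyclic-cong : ∀ {u u′ v v′ w w′} → u Fˣ.≈ u′ → v Fˣ.≈ v′ → w Fˣ.≈ w′ →
                cyclic u v w T₂.≈ᴹ cyclic u′ v′ w′
  cyclic-cong {u} {u′} {v} {v′} {w} {w′} p q r = sum₃-cong
    (bracket w u) (bracket w′ u′) (bracket u v) (bracket u′ v′) (bracket v w) (bracket v′ w′)
    (bracket-cong {w} {w′} {u} {u′} r p)
    (bracket-cong {u} {u′} {v} {v′} p q)
    (bracket-cong {v} {v′} {w} {w′} q r)

  summand : ∀ P Q R S → proj₁ P ≈ - proj₁ S → proj₁ R ≈ - proj₁ Q →
            (B P Q T.+ᴹ T.-ᴹ B R P) T₂.≈ᴹ bracket S Q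
  summand P Q R S p r = T₂.+ᴹ-cong {B P Q} {B S Q} (B-negˡ S P Q p)
    (T₂.-ᴹ‿cong {B R P} {B Q S} (B-neg Q R S P r p))

  edge : GenericTuple 3 → Fin 3 → Unit
  edge l i = Δ l i (i ⊕ 1) (i≢i⊕1 i)

  τ₀²-tuple≈cyclic : ∀ l → τ₀²-tuple l T₂.≈ᴹ cyclic (edge l 0F) (edge l 1F) (edge l 2F)
  τ₀²-tuple≈cyclic l = sum₃-cong _ (bracket (q 2F) (q 0F)) _ (bracket (q 0F) (q 1F)) _ (bracket (q 1F) (q 2F))
    (summand (p 0F) (q 0F) (r 0F) (q 2F) (anti 2F 0F) (anti 0F 1F))
    (summand (p 1F) (q 1F) (r 1F) (q 0F) (anti 0F 1F) (anti 1F 2F))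
    (summand (p 2F) (q 2F) (r 2F) (q 1F) (anti 1F 2F) (anti 2F 0F))
    where
    p q r : Fin 3 → Unit
    p i = Δ l i (i ⊕ 2) (i≢i⊕2 i)
    q = edge l
    r i = Δ l (i ⊕ 1) i (i≢i⊕1 i ∘ ≡.sym)

    anti : ∀ i j → ω (vector l j) (vector l i) ≈ - ω (vector l i) (vector l j)
    anti i j = P.antisymmetric (vector l i) (vector l j)

  τ₀²-respects : ∀ l l′ (g : GL V) → (∀ i → proj₁ g (vector l i) ≈ᴹ vector l′ i) →
                τ₀²-tuple l T₂.≈ᴹ τ₀²-tuple l′
  τ₀²-respects l l′ g p = T₂.≈ᴹ-sym {τ₀²-tuple l′} {τ₀²-tuple l} (
    T₂.≈ᴹ-trans {τ₀²-tuple l′} {cyc′} {τ₀²-tuple l} (τ₀²-tuple≈cyclic l′) (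
    T₂.≈ᴹ-trans {cyc′} {cycₖ} {τ₀²-tuple l}
      (cyclic-cong {q′ 0F} {kq 0F} {q′ 1F} {kq 1F} {q′ 2F} {kq 2F} (scale 0F) (scale 1F) (scale 2F)) (
    T₂.≈ᴹ-trans {cycₖ} {cyc} {τ₀²-tuple l} (cyclic-scale G.k (q 0F) (q 1F) (q 2F))
      (T₂.≈ᴹ-sym {τ₀²-tuple l} {cyc} (τ₀²-tuple≈cyclic l)))))
    where
    module G = GLScale {l = l} {l′} g p (i≢i⊕1 0F)
    q q′ kq : Fin 3 → Unit
    q = edge l
    q′ = edge l′
    kq i = G.k Fˣ.∙ q i
    cyc = cyclic (q 0F) (q 1F) (q 2F)
    cyc′ = cyclic (q′ 0F) (q′ 1F) (q′ 2F)
    cycₖ = cyclic (kq 0F) (kq 1F) (kq 2F)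
    scale : ∀ i → q′ i Fˣ.≈ kq i
    scale i = G.Δ-scale i (i ⊕ 1) (i≢i⊕1 i)

  -- Changing (l₀, l₁, l₂) within its GL(V)-orbit changes the value in F ⊗ Fˣ by
  -- 2-torsion, so τ₀² is a map on C₃(2) only after that torsion is divided out.

  τ₀² : GroupHomomorphism (AbelianGroup.rawGroup (C 3)) (LeftModule.+ᴹ-rawGroup (F⊗Fˣ / twoTorsion F⊗Fˣ))
  τ₀² = Presentation.extendHom _∼_ T₂.+ᴹ-abelianGroup τ₀²-tuple
    (λ { (orbit l l′ g p) → τ₀²-respects l l′ g p })

  cross : GenericTuple 4 → Unit
  cross l = (Δ l 0F 3F (λ ()) Fˣ.∙ Δ l 1F 2F (λ ())) Fˣ.∙ (Δ l 0F 2F (λ ()) Fˣ.∙ Δ l 1F 3F (λ ())) Fˣ.⁻¹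

  cross≉1 : ∀ l → proj₁ (cross l) ≉ 1#
  cross≉1 l r≈1 = *-≉0 (Δ≉0 l {0F} {1F} (λ ())) (Δ≉0 l {2F} {3F} (λ ())) (begin
    ϖ 0F 1F * ϖ 2F 3F                       ≈⟨ P.plücker (vector l 0F) (vector l 1F) (vector l 2F) (vector l 3F) ⟩
    ϖ 2F 1F * ϖ 0F 3F + ϖ 0F 2F * ϖ 1F 3F   ≈⟨ +-cong (*-congʳ (P.antisymmetric (vector l 1F) (vector l 2F))) (sym numerator) ⟩
    - ϖ 1F 2F * ϖ 0F 3F + ϖ 0F 3F * ϖ 1F 2F ≈⟨ +-cong (sym (RP.-‿distribˡ-* _ _)) (*-comm _ _) ⟩
    - (ϖ 1F 2F * ϖ 0F 3F) + ϖ 1F 2F * ϖ 0F 3F ≈⟨ -‿inverseˡ _ ⟩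
    0#                                      ∎)
    where
    open SetoidReasoning setoid
    ϖ : Fin 4 → Fin 4 → Carrier
    ϖ i j = ω (vector l i) (vector l j)
    den : Unit
    den = Δ l 0F 2F (λ ()) Fˣ.∙ Δ l 1F 3F (λ ())
    numerator : ϖ 0F 3F * ϖ 1F 2F ≈ ϖ 0F 2F * ϖ 1F 3F
    numerator = begin
      ϖ 0F 3F * ϖ 1F 2F                     ≈⟨ *-identityʳ _ ⟨
      ϖ 0F 3F * ϖ 1F 2F * 1#                ≈⟨ *-congˡ (inv-inverseˡ den) ⟨
      ϖ 0F 3F * ϖ 1F 2F * (inv den * proj₁ den) ≈⟨ *-assoc _ _ _ ⟨
      proj₁ (cross l) * proj₁ den           ≈⟨ *-congʳ r≈1 ⟩
      1# * proj₁ den                        ≈⟨ *-identityˡ _ ⟩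
      ϖ 0F 2F * ϖ 1F 3F                     ∎

  r : GenericTuple 4 → F••
  r l = proj₁ (cross l) , proj₂ (cross l) , cross≉1 l

  τ₁²-tuple : GenericTuple 4 → LeftModule.Carrierᴹ β₂ᴰ
  τ₁²-tuple l = ⟦ r l ⟧₂ᴰ , generator (r l)

  private
    cross-invariant : ∀ l l′ (g : GL V) → (∀ i → proj₁ g (vector l i) ≈ᴹ vector l′ i) →
                      cross l Fˣ.≈ cross l′
    cross-invariant l l′ g p = Fˣ.sym {cross l′} {cross l} (Q.begin
      cross l′
        Q.≈⟨ Fˣ.∙-cong {Δ′03 Fˣ.∙ Δ′12} {(k Fˣ.∙ Δ03) Fˣ.∙ (k Fˣ.∙ Δ12)}
               {(Δ′02 Fˣ.∙ Δ′13) Fˣ.⁻¹} {((k Fˣ.∙ Δ02) Fˣ.∙ (k Fˣ.∙ Δ13)) Fˣ.⁻¹}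
               (*-cong (Δ-scale 0F 3F (λ ())) (Δ-scale 1F 2F (λ ())))
               (Fˣ.⁻¹-cong {Δ′02 Fˣ.∙ Δ′13} {(k Fˣ.∙ Δ02) Fˣ.∙ (k Fˣ.∙ Δ13)}
                 (*-cong (Δ-scale 0F 2F (λ ())) (Δ-scale 1F 3F (λ ())))) ⟩
      ((k Fˣ.∙ Δ03) Fˣ.∙ (k Fˣ.∙ Δ12)) Fˣ.∙ ((k Fˣ.∙ Δ02) Fˣ.∙ (k Fˣ.∙ Δ13)) Fˣ.⁻¹
        Q.≈⟨ ratio-scale Fˣ k Δ03 Δ12 Δ02 Δ13 ⟩
      cross l Q.∎)
      where
      open GLScale {l = l} {l′} g p {0F} {1F} (λ ())
      module Q = SetoidReasoning Fˣ.setoid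
      Δ03 = Δ l 0F 3F (λ ())
      Δ12 = Δ l 1F 2F (λ ())
      Δ02 = Δ l 0F 2F (λ ())
      Δ13 = Δ l 1F 3F (λ ())
      Δ′03 = Δ l′ 0F 3F (λ ())
      Δ′12 = Δ l′ 1F 2F (λ ())
      Δ′02 = Δ l′ 0F 2F (λ ())
      Δ′13 = Δ l′ 1F 3F (λ ())

  τ₁² : GroupHomomorphism (AbelianGroup.rawGroup (C 4)) (LeftModule.+ᴹ-rawGroup β₂ᴰ)
  τ₁² = Presentation.extendHom _∼_ (LeftModule.+ᴹ-abelianGroup β₂ᴰ) τ₁²-tuple
    (λ { (orbit l l′ g p) → ⟦⟧₂ᴰ-cong {r l} {r l′} (cross-invariant l l′ g p) })

{-# OPTIONS --safe #-}

-- Write (ij) for Δ(lᵢ, lⱼ) and {u, v} for Dlog u ⊗ v − Dlog v ⊗ u, which is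
-- biadditive and alternating; put c(x, y, z) = {z, x} + {x, y} + {y, z}.
-- Modulo 2-torsion τ₀²(lᵢ, lⱼ, lₖ) = c((ij), (jk), (ik)). By the Plücker
-- relation 1 − r = (01)(23) / (02)(13), and {x/z, y/z} = c(x, y, z), so
-- ∂ᴰ⟦r⟧ = {r, 1 − r} = c((03)(12), (01)(23), (02)(13)). Expanded by biadditivity
-- this has twelve terms, and these are the twelve terms of τ₀² ∘ d.
module Submission where

open import Algebra.Bundles using (AbelianGroup)
open import Algebra.Morphism.Bundles using (module GroupHomomorphism)
open import Algebra.Module.Bundles using (LeftModule)
import Algebra.Properties.AbelianGroup as AbelianGroupProperties
import Algebra.Properties.Ring as RingProperties
import Algebra.Solver.CommutativeMonoid as CommutativeMonoidSolver
open import Data.Fin.Base using (Fin)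
open import Data.Fin.Patterns using (0F; 1F; 2F; 3F)
open import Data.Product.Base using (proj₁)
import Relation.Binary.Reasoning.Setoid as SetoidReasoning
open import Defs

-- Brackets and cyclic sums of a biadditive map.

module BiadditiveProperties {u ℓu g ℓg} (U : AbelianGroup u ℓu) (G : AbelianGroup g ℓg) where
  private
    module U = AbelianGroup U
  open AbelianGroup G
  open AbelianGroupProperties G
  open SetoidReasoning setoid

  module Laws
           (B : U.Carrier → U.Carrier → Carrier)
           (B-cong : ∀ {x x′ y y′} → x U.≈ x′ → y U.≈ y′ → B x y ≈ B x′ y′)
           (B-distribˡ : ∀ x y z → B x (y U.∙ z) ≈ B x y ∙ B x z)
           (B-distribʳ : ∀ x y z → B (x U.∙ y) z ≈ B x z ∙ B y z) where

    open Antisymmetrisation.Biadditive U G B B-distribˡ B-distribʳ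
    private
      module S = CommutativeMonoidSolver commutativeMonoid

    bracket-cong : ∀ {x x′ y y′} → x U.≈ x′ → y U.≈ y′ → bracket x y ≈ bracket x′ y′
    bracket-cong p q = ∙-cong (B-cong p q) (⁻¹-cong (B-cong q p))

    cyclic-cong : ∀ {x x′ y y′ z z′} → x U.≈ x′ → y U.≈ y′ → z U.≈ z′ →
                  cyclic x y z ≈ cyclic x′ y′ z′
    cyclic-cong p q r =
      ∙-cong (bracket-cong r p) (∙-cong (bracket-cong p q) (∙-congʳ (bracket-cong q r)))

    bracket-antisym : ∀ x y → bracket x y ⁻¹ ≈ bracket y x
    bracket-antisym x y = ⁻¹-anti-homo‿- (B x y) (B y x)

    bracket-distribˡ : ∀ x y z → bracket x (y U.∙ z) ≈ bracket x y ∙ bracket x z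
    bracket-distribˡ x y z = begin
      B x (y U.∙ z) ∙ B (y U.∙ z) x ⁻¹
        ≈⟨ ∙-cong (B-distribˡ x y z) (trans (⁻¹-cong (B-distribʳ y z x)) (sym (⁻¹-∙-comm _ _))) ⟩
      (B x y ∙ B x z) ∙ (B y x ⁻¹ ∙ B z x ⁻¹)
        ≈⟨ S.solve 4 (λ p q r s → (p S.⊕ q) S.⊕ (r S.⊕ s) S.⊜ (p S.⊕ r) S.⊕ (q S.⊕ s)) refl _ _ _ _ ⟩
      bracket x y ∙ bracket x z ∎

    bracket-distribʳ : ∀ x y z → bracket (x U.∙ y) z ≈ bracket x z ∙ bracket y z
    bracket-distribʳ x y z = begin
      bracket (x U.∙ y) z            ≈⟨ bracket-antisym z (x U.∙ y) ⟨
      bracket z (x U.∙ y) ⁻¹         ≈⟨ ⁻¹-cong (bracket-distribˡ z x y) ⟩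
      (bracket z x ∙ bracket z y) ⁻¹ ≈⟨ ⁻¹-∙-comm _ _ ⟨
      bracket z x ⁻¹ ∙ bracket z y ⁻¹ ≈⟨ ∙-cong (bracket-antisym z x) (bracket-antisym z y) ⟩
      bracket x z ∙ bracket y z      ∎

    bracket-distrib : ∀ a b x y → bracket (a U.∙ b) (x U.∙ y) ≈
                      (bracket a x ∙ bracket a y) ∙ (bracket b x ∙ bracket b y)
    bracket-distrib a b x y = trans (bracket-distribʳ a b (x U.∙ y))
      (∙-cong (bracket-distribˡ a x y) (bracket-distribˡ b x y))

    bracket-identityʳ : ∀ x → bracket x U.ε ≈ ε
    bracket-identityʳ x = identityʳ-unique (bracket x U.ε) (bracket x U.ε) (begin
      bracket x U.ε ∙ bracket x U.ε ≈⟨ bracket-distribˡ x U.ε U.ε ⟨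
      bracket x (U.ε U.∙ U.ε)       ≈⟨ bracket-cong U.refl (U.identityˡ U.ε) ⟩
      bracket x U.ε                 ∎)

    bracket-identityˡ : ∀ x → bracket U.ε x ≈ ε
    bracket-identityˡ x = begin
      bracket U.ε x    ≈⟨ bracket-antisym x U.ε ⟨
      bracket x U.ε ⁻¹ ≈⟨ ⁻¹-cong (bracket-identityʳ x) ⟩
      ε ⁻¹             ≈⟨ ε⁻¹≈ε ⟩
      ε                ∎

    -- Swapping the first two arguments reverses each of the three brackets, so a minus sign on a
    -- face can be absorbed into the order of its edges.
    cyclic-antisym : ∀ x y z → cyclic x y z ⁻¹ ≈ cyclic y x z
    cyclic-antisym x y z = begin
      (bracket z x ∙ (bracket x y ∙ (bracket y z ∙ ε))) ⁻¹
        ≈⟨ ⁻¹-cong (∙-congˡ (∙-congˡ (identityʳ _))) ⟩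
      (bracket z x ∙ (bracket x y ∙ bracket y z)) ⁻¹
        ≈⟨ trans (∙-congˡ (⁻¹-∙-comm _ _)) (⁻¹-∙-comm _ _) ⟨
      bracket z x ⁻¹ ∙ (bracket x y ⁻¹ ∙ bracket y z ⁻¹)
        ≈⟨ ∙-cong (bracket-antisym z x) (∙-cong (bracket-antisym x y) (bracket-antisym y z)) ⟩
      bracket x z ∙ (bracket y x ∙ bracket z y)
        ≈⟨ S.solve 3 (λ p q r → p S.⊕ (q S.⊕ r) S.⊜ r S.⊕ (q S.⊕ (p S.⊕ S.id))) refl _ _ _ ⟩
      cyclic y x z ∎

    -- `cyclic` does not change when its three arguments share a factor (`cyclic-scale`). Dividing
    -- them by `z` turns the third into `U.ε`, and the two brackets that contain it vanish.
    bracket-ratio : ∀ x y z → bracket (x U.∙ z U.⁻¹) (y U.∙ z U.⁻¹) ≈ cyclic x y z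
    bracket-ratio x y z = begin
      bracket x/z y/z                                            ≈⟨ identityʳ _ ⟨
      bracket x/z y/z ∙ ε                                        ≈⟨ identityˡ _ ⟨
      ε ∙ (bracket x/z y/z ∙ ε)                                  ≈⟨ ∙-congˡ (∙-congˡ (identityˡ ε)) ⟨
      ε ∙ (bracket x/z y/z ∙ (ε ∙ ε))
        ≈⟨ ∙-cong (bracket-identityˡ x/z) (∙-congˡ (∙-congʳ (bracket-identityʳ y/z))) ⟨
      cyclic x/z y/z U.ε
        ≈⟨ cyclic-cong (U.comm x (z U.⁻¹)) (U.comm y (z U.⁻¹)) (U.sym (U.inverseˡ z)) ⟩
      cyclic (z U.⁻¹ U.∙ x) (z U.⁻¹ U.∙ y) (z U.⁻¹ U.∙ z)        ≈⟨ cyclic-scale (z U.⁻¹) x y z ⟩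
      cyclic x y z                                               ∎
      where
      x/z = x U.∙ z U.⁻¹
      y/z = y U.∙ z U.⁻¹

    -- The sum over the four faces of a tetrahedron whose edges carry the xᵢⱼ,
    -- against the pairs of opposite edges.
    tetrahedron : ∀ x₀₁ x₀₂ x₀₃ x₁₂ x₁₃ x₂₃ →
      cyclic x₁₂ x₂₃ x₁₃ ∙ (cyclic x₀₂ x₂₃ x₀₃ ⁻¹ ∙
        (cyclic x₀₁ x₁₃ x₀₃ ⁻¹ ⁻¹ ∙ (cyclic x₀₁ x₁₂ x₀₂ ⁻¹ ⁻¹ ⁻¹ ∙ ε)))
      ≈ cyclic (x₀₃ U.∙ x₁₂) (x₀₁ U.∙ x₂₃) (x₀₂ U.∙ x₁₃)
    tetrahedron x₀₁ x₀₂ x₀₃ x₁₂ x₁₃ x₂₃ = begin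
      cyclic x₁₂ x₂₃ x₁₃ ∙ (cyclic x₀₂ x₂₃ x₀₃ ⁻¹ ∙
        (cyclic x₀₁ x₁₃ x₀₃ ⁻¹ ⁻¹ ∙ (cyclic x₀₁ x₁₂ x₀₂ ⁻¹ ⁻¹ ⁻¹ ∙ ε)))
        -- There is one inverse per factor -1 in the sign of the face: pairs cancel, and a remaining
        -- one becomes a swap of arguments.
        ≈⟨ ∙-congˡ (∙-cong (cyclic-antisym x₀₂ x₂₃ x₀₃) (∙-cong (⁻¹-involutive _)
             (∙-congʳ (trans (⁻¹-involutive _) (cyclic-antisym x₀₁ x₁₂ x₀₂))))) ⟩
      cyclic x₁₂ x₂₃ x₁₃ ∙ (cyclic x₂₃ x₀₂ x₀₃ ∙ (cyclic x₀₁ x₁₃ x₀₃ ∙ (cyclic x₁₂ x₀₁ x₀₂ ∙ ε)))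
        -- Edges of one face are never opposite, so each of the twelve brackets joins two different
        -- pairs of opposite edges. Each group of four takes one bracket from every face and expands
        -- the bracket of two such pairs.
        ≈⟨ S.solve 12 (λ a₁ a₂ a₃ b₁ b₂ b₃ c₁ c₂ c₃ d₁ d₂ d₃ →
             (a₁ S.⊕ (a₂ S.⊕ (a₃ S.⊕ S.id))) S.⊕ ((b₁ S.⊕ (b₂ S.⊕ (b₃ S.⊕ S.id))) S.⊕
               ((c₁ S.⊕ (c₂ S.⊕ (c₃ S.⊕ S.id))) S.⊕ ((d₁ S.⊕ (d₂ S.⊕ (d₃ S.⊕ S.id))) S.⊕ S.id)))
             S.⊜ ((b₃ S.⊕ d₁) S.⊕ (c₃ S.⊕ a₁)) S.⊕ (((c₁ S.⊕ b₁) S.⊕ (d₂ S.⊕ a₂)) S.⊕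
               (((d₃ S.⊕ c₂) S.⊕ (b₂ S.⊕ a₃)) S.⊕ S.id)))
           refl _ _ _ _ _ _ _ _ _ _ _ _ ⟩
      ((bracket x₀₂ x₀₃ ∙ bracket x₀₂ x₁₂) ∙ (bracket x₁₃ x₀₃ ∙ bracket x₁₃ x₁₂)) ∙
        (((bracket x₀₃ x₀₁ ∙ bracket x₀₃ x₂₃) ∙ (bracket x₁₂ x₀₁ ∙ bracket x₁₂ x₂₃)) ∙
        (((bracket x₀₁ x₀₂ ∙ bracket x₀₁ x₁₃) ∙ (bracket x₂₃ x₀₂ ∙ bracket x₂₃ x₁₃)) ∙ ε))
        ≈⟨ ∙-cong (bracket-distrib x₀₂ x₁₃ x₀₃ x₁₂) (∙-cong (bracket-distrib x₀₃ x₁₂ x₀₁ x₂₃)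
             (∙-congʳ (bracket-distrib x₀₁ x₂₃ x₀₂ x₁₃))) ⟨
      cyclic (x₀₃ U.∙ x₁₂) (x₀₁ U.∙ x₂₃) (x₀₂ U.∙ x₁₃) ∎

module Square {c ℓ m ℓm} (F : Field c ℓ) (derivation : Derivation F)
              (V : VectorSpace F m ℓm) (e : Basis V 2) (volume : VolumeForm F V) where
  open Field F
  open FieldConstructions F
  open DerivationConstructions derivation
  open Configurations {F = F} V
  open Maps derivation e volume
  open VolumeForm volume using (ω; form)
  private
    module RP = RingProperties ring
    module Fˣ = AbelianGroup Fˣ
    module P = PlaneForm e form
    module T = LeftModule F⊗Fˣ
    module TP = AbelianGroupProperties T.+ᴹ-abelianGroup
    module T₂ = LeftModule (F⊗Fˣ / twoTorsion F⊗Fˣ)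
    module mod2 = LinearMap mod2

    B-cong₂ : ∀ {u u′ v v′} → u Fˣ.≈ u′ → v Fˣ.≈ v′ → B u v ≈₂ B u′ v′
    B-cong₂ {u} {u′} {v} {v′} = B-cong {u} {u′} {v} {v′}

    module BP = BiadditiveProperties Fˣ T₂.+ᴹ-abelianGroup
    module BL = BP.Laws B B-cong₂ B-distribˡ B-distribʳ

  -- Signs and orderings of determinants modulo 2-torsion.

  ⊗-zeroˡ : ∀ u → 0# ⊗ u T.≈ᴹ T.0ᴹ
  ⊗-zeroˡ u = TP.identityʳ-unique (0# ⊗ u) (0# ⊗ u)
    (T.≈ᴹ-trans (T.≈ᴹ-sym (⊗-distribʳ 0# 0# u)) (⊗-cong (+-identityˡ 0#) refl))

  ⊗-negˡ : ∀ a u → (- a) ⊗ u T.≈ᴹ T.-ᴹ (a ⊗ u)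
  ⊗-negˡ a u = TP.inverseˡ-unique _ _
    (T.≈ᴹ-trans (T.≈ᴹ-sym (⊗-distribʳ (- a) a u))
    (T.≈ᴹ-trans (⊗-cong (-‿inverseˡ a) refl) (⊗-zeroˡ u)))

  -- Reordering the summands and pulling the minus sign out of the left factor is already valid in
  -- `F⊗Fˣ`; no torsion is lost here.
  ∂-bracket : ∀ a → ∂-Span (generator a) ≈₂ bracket ⌊ a ⌋ (1- a)
  ∂-bracket a = mod2.⟦⟧-cong {∂-Span (generator a)} {bracket ⌊ a ⌋ (1- a)}
    (T.≈ᴹ-trans (T.+ᴹ-comm _ _) (T.+ᴹ-congˡ (⊗-negˡ (Dlog (1- a)) ⌊ a ⌋)))

  -- `Dlog` does not see the sign of its argument, so only the term with `u` in the right factor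
  -- costs 2-torsion.
  bracket-negˡ : ∀ u u′ v → proj₁ u′ ≈ - proj₁ u → bracket u′ v ≈₂ bracket u v
  bracket-negˡ u u′ v p = T₂.+ᴹ-cong {B u′ v} {B u v} (B-negˡ u u′ v p)
    (T₂.-ᴹ‿cong {B v u′} {B v u} (⊗-neg (Dlog v) u u′ p))

  bracket-negʳ : ∀ u v v′ → proj₁ v′ ≈ - proj₁ v → bracket u v′ ≈₂ bracket u v
  bracket-negʳ u v v′ p = T₂.+ᴹ-cong {B u v′} {B u v} (⊗-neg (Dlog u) v v′ p)
    (T₂.-ᴹ‿cong {B v′ u} {B v u} (B-negˡ v v′ u p))

  cyclic-neg : ∀ u v w w′ → proj₁ w′ ≈ - proj₁ w → cyclic u v w′ ≈₂ cyclic u v w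
  cyclic-neg u v w w′ p = sum₃-cong
    (bracket w′ u) (bracket w u) (bracket u v) (bracket u v) (bracket v w′) (bracket v w)
    (bracket-negˡ w w′ u p) (T₂.≈ᴹ-refl {bracket u v}) (bracket-negʳ v w w′ p)

  -- Indices mod 3 make the third edge Δ(l₂, l₀), which `cyclic-neg` turns into Δ(l₀, l₂). Only the
  -- field elements under `u`, `v`, `w` are constrained, so two faces with a common edge can use the
  -- same unit, whatever the proof of nonvanishing.
  τ₀²-tuple≈cyclic-ordered : ∀ l {u v w : Unit} →
    proj₁ u ≈ ω (vector l 0F) (vector l 1F) →
    proj₁ v ≈ ω (vector l 1F) (vector l 2F) →
    proj₁ w ≈ ω (vector l 0F) (vector l 2F) →
    τ₀²-tuple l ≈₂ cyclic u v w
  τ₀²-tuple≈cyclic-ordered l {u} {v} {w} p q r =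
    T₂.≈ᴹ-trans {τ₀²-tuple l} {cyc} {cyclic u v w} (τ₀²-tuple≈cyclic l)
    (T₂.≈ᴹ-trans {cyc} {cyc′} {cyclic u v w}
      (cyclic-cong {edge l 0F} {u} {edge l 1F} {v} {edge l 2F} {edge l 2F} (sym p) (sym q) refl)
      (cyclic-neg u v w (edge l 2F)
        (trans (P.antisymmetric (vector l 0F) (vector l 2F)) (-‿cong (sym r)))))
    where
    cyc = cyclic (edge l 0F) (edge l 1F) (edge l 2F)
    cyc′ = cyclic u v (edge l 2F)

  -- The cross-ratio of four vectors and the square on a generator.

  module _ (l : GenericTuple 4) where
    private
      Δ₀₁ Δ₀₂ Δ₀₃ Δ₁₂ Δ₁₃ Δ₂₃ : Unit
      Δ₀₁ = Δ l 0F 1F (λ ())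
      Δ₀₂ = Δ l 0F 2F (λ ())
      Δ₀₃ = Δ l 0F 3F (λ ())
      Δ₁₂ = Δ l 1F 2F (λ ())
      Δ₁₃ = Δ l 1F 3F (λ ())
      Δ₂₃ = Δ l 2F 3F (λ ())

      numerator conumerator denominator : Unit
      numerator = Δ₀₃ Fˣ.∙ Δ₁₂
      conumerator = Δ₀₁ Fˣ.∙ Δ₂₃
      denominator = Δ₀₂ Fˣ.∙ Δ₁₃

    -- `P.plücker` writes (01)(23) as (21)(03) + (02)(13); adding (03)(12) cancels the first term,
    -- since (21) = -(12).
    plücker-sum : proj₁ conumerator + proj₁ numerator ≈ proj₁ denominator
    plücker-sum = begin
      ϖ 0F 1F * ϖ 2F 3F + ϖ 0F 3F * ϖ 1F 2F
        ≈⟨ +-cong (P.plücker (vector l 0F) (vector l 1F) (vector l 2F) (vector l 3F)) (*-comm _ _) ⟩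
      (ϖ 2F 1F * ϖ 0F 3F + ϖ 0F 2F * ϖ 1F 3F) + ϖ 1F 2F * ϖ 0F 3F
        ≈⟨ trans (+-congʳ (+-comm _ _)) (+-assoc _ _ _) ⟩
      ϖ 0F 2F * ϖ 1F 3F + (ϖ 2F 1F * ϖ 0F 3F + ϖ 1F 2F * ϖ 0F 3F)
        ≈⟨ +-congˡ (distribʳ _ _ _) ⟨
      ϖ 0F 2F * ϖ 1F 3F + (ϖ 2F 1F + ϖ 1F 2F) * ϖ 0F 3F
        ≈⟨ +-congˡ (*-congʳ (trans (+-congʳ (P.antisymmetric _ _)) (-‿inverseˡ _))) ⟩
      ϖ 0F 2F * ϖ 1F 3F + 0# * ϖ 0F 3F
        ≈⟨ trans (+-congˡ (zeroˡ _)) (+-identityʳ _) ⟩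
      ϖ 0F 2F * ϖ 1F 3F ∎
      where
      open SetoidReasoning setoid
      ϖ : Fin 4 → Fin 4 → Carrier
      ϖ i j = ω (vector l i) (vector l j)

    1-r : 1- r l Fˣ.≈ conumerator Fˣ.∙ denominator Fˣ.⁻¹
    1-r = sym (RP.x≈z//y _ _ _ (begin
      proj₁ conumerator * inv denominator + proj₁ numerator * inv denominator ≈⟨ distribʳ _ _ _ ⟨
      (proj₁ conumerator + proj₁ numerator) * inv denominator ≈⟨ *-congʳ plücker-sum ⟩
      proj₁ denominator * inv denominator                     ≈⟨ inv-inverseʳ denominator ⟩
      1#                                                      ∎))
      where open SetoidReasoning setoid

    -- Both sides reduce to `opposite`: the faces by `tetrahedron`, and ∂ᴰ by `bracket-ratio`,
    -- because r and 1 - r are fractions over the same `denominator`.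
    commutes-on-tuple :
      GroupHomomorphism.⟦_⟧ τ₀² (face l) ≈₂ ∂-Span (generator (r l))
    commutes-on-tuple =
      T₂.≈ᴹ-trans {GroupHomomorphism.⟦_⟧ τ₀² (face l)} {faces} {∂r} expand-faces
      (T₂.≈ᴹ-trans {faces} {opposite} {∂r} (BL.tetrahedron Δ₀₁ Δ₀₂ Δ₀₃ Δ₁₂ Δ₁₃ Δ₂₃)
      (T₂.≈ᴹ-sym {∂r} {opposite}
      (T₂.≈ᴹ-trans {∂r} {bracket (cross l) (1- r l)} {opposite} (∂-bracket (r l))
      (T₂.≈ᴹ-trans {bracket (cross l) (1- r l)} {ratios} {opposite}
        (bracket-cong {cross l} {cross l} {1- r l} {conumerator Fˣ.∙ denominator Fˣ.⁻¹} refl 1-r)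
        (BL.bracket-ratio numerator conumerator denominator)))))
      where
      ∂r = ∂-Span (generator (r l))
      opposite = cyclic numerator conumerator denominator
      ratios = bracket (cross l) (conumerator Fˣ.∙ denominator Fˣ.⁻¹)
      c₀ = cyclic Δ₁₂ Δ₂₃ Δ₁₃
      c₁ = cyclic Δ₀₂ Δ₂₃ Δ₀₃
      c₂ = cyclic Δ₀₁ Δ₁₃ Δ₀₃
      c₃ = cyclic Δ₀₁ Δ₁₂ Δ₀₂
      faces = c₀ T.+ᴹ (T.-ᴹ c₁ T.+ᴹ (T.-ᴹ T.-ᴹ c₂ T.+ᴹ (T.-ᴹ T.-ᴹ T.-ᴹ c₃ T.+ᴹ T.0ᴹ)))
      t : Fin 4 → T.Carrierᴹ
      t i = τ₀²-tuple (omit i l)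

      neg : ∀ {u v} → u ≈₂ v → T.-ᴹ u ≈₂ T.-ᴹ v
      neg {u} {v} = T₂.-ᴹ‿cong {u} {v}

      -- The determinants of `omit i l` are by computation determinants of `l`, hence each `refl`;
      -- the final `T.0ᴹ` is the empty sum that ends `face`.
      expand-faces : GroupHomomorphism.⟦_⟧ τ₀² (face l) ≈₂ faces
      expand-faces =
        T₂.+ᴹ-cong {t 0F} {c₀} (τ₀²-tuple≈cyclic-ordered (omit 0F l) {Δ₁₂} {Δ₂₃} {Δ₁₃} refl refl refl)
        (T₂.+ᴹ-cong {T.-ᴹ t 1F} {T.-ᴹ c₁}
          (neg {t 1F} {c₁} (τ₀²-tuple≈cyclic-ordered (omit 1F l) {Δ₀₂} {Δ₂₃} {Δ₀₃} refl refl refl))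
        (T₂.+ᴹ-cong {T.-ᴹ T.-ᴹ t 2F} {T.-ᴹ T.-ᴹ c₂}
          (neg {T.-ᴹ t 2F} {T.-ᴹ c₂} (neg {t 2F} {c₂}
            (τ₀²-tuple≈cyclic-ordered (omit 2F l) {Δ₀₁} {Δ₁₃} {Δ₀₃} refl refl refl)))
        (T₂.+ᴹ-cong {T.-ᴹ T.-ᴹ T.-ᴹ t 3F} {T.-ᴹ T.-ᴹ T.-ᴹ c₃}
          (neg {T.-ᴹ T.-ᴹ t 3F} {T.-ᴹ T.-ᴹ c₃} (neg {T.-ᴹ t 3F} {T.-ᴹ c₃} (neg {t 3F} {c₃}
            (τ₀²-tuple≈cyclic-ordered (omit 3F l) {Δ₀₁} {Δ₁₂} {Δ₀₂} refl refl refl))))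
          (T₂.≈ᴹ-refl {T.0ᴹ}))))

  private
    τ₀²∘d ∂ᴰ∘τ₁² : Word (GenericTuple 4) → T.Carrierᴹ
    τ₀²∘d x = GroupHomomorphism.⟦_⟧ τ₀² (GroupHomomorphism.⟦_⟧ d x)
    ∂ᴰ∘τ₁² x = LinearMap.⟦_⟧ ∂ᴰ (GroupHomomorphism.⟦_⟧ τ₁² x)

  -- `∂-Span` follows the span proof that `τ₁²` builds along the word, so both composites split by
  -- computation over sums and negatives, and a single tuple remains.
  commutes : ∀ x → τ₀²∘d x ≈₂ ∂ᴰ∘τ₁² x
  commutes [ l ]    = commutes-on-tuple l
  commutes 0ʷ       = T₂.≈ᴹ-refl {T.0ᴹ}
  commutes (x +ʷ y) = T₂.+ᴹ-cong {τ₀²∘d x} {∂ᴰ∘τ₁² x} {τ₀²∘d y} {∂ᴰ∘τ₁² y} (commutes x) (commutes y)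
  commutes (-ʷ x)   = T₂.-ᴹ‿cong {τ₀²∘d x} {∂ᴰ∘τ₁² x} (commutes x)

proposition3p3 : ∀ {c ℓ m ℓm} (F : Field c ℓ) (D : Derivation F)
    (V : VectorSpace F m ℓm) (e : Basis V 2) (ω : VolumeForm F V) →
    let open FieldConstructions F
        open DerivationConstructions D
        open Configurations {F = F} V
        open Maps D e ω
    in ∀ (x : AbelianGroup.Carrier (C 4)) →
       GroupHomomorphism.⟦_⟧ τ₀² (GroupHomomorphism.⟦_⟧ d x)
         ≈₂ LinearMap.⟦_⟧ mod2 (LinearMap.⟦_⟧ ∂ᴰ (GroupHomomorphism.⟦_⟧ τ₁² x))
proposition3p3 F D V e ω = Square.commutes F D V e ω
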